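{- Let $\mathcal N$ be an $n$-level $\Pi^3$-net and let $m_0$ be a live marking of $\mathcal N$. Then $\mathcal R(m_0)$ equals the set $\mathcal S(m_0)$ of markings $m\in\mathbb N^P$ that satisfy the $n$-condition ($m(P_n)>0$ and $m(P_{j-1})\ge\varphi_j(m)$ for all $2\le j\le n$) and satisfy $\widetilde m(P_i)=\widetilde{m_0}(P_i)$ for all $1\le i\le n$.
   Context: A Petri net is $(P,T,W^-,W^+)$ with $W^-,W^+\in\mathbb N^{P\times T}$; ${}^\bullet t,t^\bullet$ the columns of $W^-,W^+$. Markings $m\in\mathbb N^P$, enabling ($m\ge{}^\bullet t$), firing ($m\mapsto m-{}^\bullet t+t^\bullet$), reachability set $\mathcal R(m_0)$ as usual; $m_0$ is live if from every marking of $\mathcal R(m_0)$ every transition can be enabled again; $x(P')=\sum_{p\in P'}x(p)$. Weakly reversible: every connected component of the reaction graph (nodes $\{{}^\bullet t\}\cup\{t^\bullet\}$, arcs $({}^\bullet t,t^\bullet)$) is strongly connected. For $n\ge2$, an $n$-level ordered $\Pi$-net is a weakly reversible net with partitions $P=P_1\sqcup\dots\sqcup P_n$, $T=T_1\sqcup\dots\sqcup T_n$ such that: (1) each $P_i\ne\emptyset$; (2) $(P_i,T_i,W^-|_{P_i\times T_i},W^+|_{P_i\times T_i})$ is a strongly connected state machine (each transition of $T_i$ has exactly one input and one output place in $P_i$, with weight $1$); (3) for $t\in T_i$, ${}^\bullet t(p)>0$ implies $p\in P_i\cup P_{i-1}$ ($P_0=\emptyset$); (4) for $2\le i\le n$ some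 $t\in T_i$, $p\in P_{i-1}$ have ${}^\bullet t(p)>0$; (5) for $t,t'\in T_i$, if ${}^\bullet t$ and ${}^\bullet t'$ share a place of $P_i$ then ${}^\bullet t={}^\bullet t'$. Potentials: for $p\in P_i$ ($i\ge2$), $q\in P_{i-1}$, $pot(p,q)=t^\bullet(q)$ if some $t\in T_i$ has $t^\bullet(p)>0$ and $t^\bullet(q)>0$ (independent of $t$), else $0$; $pot(p)=\sum_{q\in P_{i-1}}pot(p,q)$ for $p\in P_i$, $i\ge2$; $pot(p)=0$ for $p\in P_1$. A $\Pi^3$-net is an ordered $\Pi$-net such that for every $1\le i\le n-1$ and $p\in P_i$ with ${}^\bullet t(p)>0$ for some $t\in T_{i+1}$, $pot(p)=\max\{pot(q):q\in P_i\}$. For $2\le i\le n$: $\varphi_i(m)=\max\{pot(p):p\in P_i\}$ if $m(P_i)=0$, else $\varphi_i(m)=\min\{pot(p):p\in P_i, m(p)>0\}$. The marking witness of $m\in\mathbb Z^P$ is given for $p\in P_i$ by $\widetilde m(p)=m(p)+\sum_{j=1}^{n-i}(-1)^j\sum_{r_1\in P_{i+1},\dots,r_j\in P_{i+j}}m(r_j)\big(\prod_{k=1}^{j-1}pot(r_{k+1},r_k)\big)pot(r_1,p)$. -}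

module Defs where

import Data.Nat
open import Data.Nat using (ℕ; zero; suc; _+_; _*_; _∸_; _≤_; _<_; _⊓_; _⊔_; _≤?_)
open import Data.Fin using (Fin; toℕ) renaming (zero to fz; suc to fs; _≟_ to _≟F_)
open import Data.Vec using (Vec; lookup; tabulate)
open import Data.Bool using (Bool; true; false; _∧_; if_then_else_)
open import Data.Maybe using (Maybe; just; nothing)
open import Data.Integer as ℤ using (ℤ; +_)
open import Data.Product using (Σ; ∃; ∃₂; _×_; _,_)
open import Data.Sum using (_⊎_)
open import Relation.Binary.PropositionalEquality using (_≡_; _≢_)
open import Relation.Nullary.Decidable using (⌊_⌋)
open import Relation.Binary.Construct.Closure.ReflexiveTransitive using (Star)
open import Relation.Binary.Construct.Closure.Symmetric using (SymClosure)

sumF : (k : ℕ) → (Fin k → ℕ) → ℕ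
sumF zero    f = 0
sumF (suc k) f = f fz + sumF k (λ i → f (fs i))

sumZ : (k : ℕ) → (Fin k → ℤ) → ℤ
sumZ zero    f = + 0
sumZ (suc k) f = f fz ℤ.+ sumZ k (λ i → f (fs i))

-- maximum of f over the selected indices (0 if none are selected;
-- all values are natural numbers so 0 is a neutral base)
maxSel : (k : ℕ) → (Fin k → Bool) → (Fin k → ℕ) → ℕ
maxSel zero    s f = 0
maxSel (suc k) s f =
  (if s fz then f fz else 0) ⊔ maxSel k (λ i → s (fs i)) (λ i → f (fs i))

minM : ℕ → Maybe ℕ → ℕ
minM a nothing  = a
minM a (just b) = a ⊓ b

minSel : (k : ℕ) → (Fin k → Bool) → (Fin k → ℕ) → Maybe ℕ
minSel zero    s f = nothing
minSel (suc k) s f with minSel k (λ i → s (fs i)) (λ i → f (fs i))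
... | r = if s fz then just (minM (f fz) r) else r

firstJust : {A : Set} (k : ℕ) → (Fin k → Maybe A) → Maybe A
firstJust zero    g = nothing
firstJust (suc k) g with g fz
... | just a  = just a
... | nothing = firstJust k (λ i → g (fs i))

fromMaybe0 : Maybe ℕ → ℕ
fromMaybe0 nothing  = 0
fromMaybe0 (just v) = v

negPow : ℕ → ℤ
negPow zero    = + 1
negPow (suc j) = ℤ.- negPow j

-- Leveled Petri nets: places Fin np, transitions Fin nt,
-- pre t = column t of W⁻ (= •t), post t = column t of W⁺ (= t•),
-- levels Fin n, level index k : Fin n stands for level k+1.

record LNet : Set where
  field
    np nt : ℕ
    pre post : Fin nt → Fin np → ℕ
    n : ℕ
    lvP : Fin np → Fin n
    lvT : Fin nt → Fin n

module _ (L : LNet) where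
  open LNet L

  Marking : Set
  Marking = Vec ℕ np

  Enabled : Marking → Fin nt → Set
  Enabled m t = ∀ p → pre t p ≤ lookup m p

  fire : Marking → Fin nt → Marking
  fire m t = tabulate (λ p → lookup m p ∸ pre t p + post t p)

  Step : Marking → Marking → Set
  Step m m' = Σ (Fin nt) λ t → Enabled m t × m' ≡ fire m t

  Reach : Marking → Marking → Set
  Reach = Star Step

  Live : Marking → Set
  Live m0 = ∀ m → Reach m0 m → ∀ t → ∃ λ m' → Reach m m' × Enabled m' t

  Complex : Set
  Complex = Vec ℕ np

  Arc : Complex → Complex → Set
  Arc c d = Σ (Fin nt) λ t → c ≡ tabulate (pre t) × d ≡ tabulate (post t)

  WeaklyReversible : Set
  WeaklyReversible = ∀ c d → Star (SymClosure Arc) c d → Star Arc c d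

  Below : Fin np → Fin np → Set
  Below q p = suc (toℕ (lvP q)) ≡ toℕ (lvP p)

  SMStep : Fin n → Fin np → Fin np → Set
  SMStep i p q = Σ (Fin nt) λ t →
    lvT t ≡ i × lvP p ≡ i × lvP q ≡ i × 0 < pre t p × 0 < post t q

  record IsOrderedΠNet : Set where
    field
      two≤n     : 2 ≤ n
      weakRev   : WeaklyReversible
      nonEmpty  : ∀ (i : Fin n) → ∃ λ p → lvP p ≡ i
      smIn      : ∀ t → ∃ λ p → lvP p ≡ lvT t × pre t p ≡ 1 ×
                    (∀ q → lvP q ≡ lvT t → q ≢ p → pre t q ≡ 0)
      smOut     : ∀ t → ∃ λ p → lvP p ≡ lvT t × post t p ≡ 1 ×
                    (∀ q → lvP q ≡ lvT t → q ≢ p → post t q ≡ 0)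
      smStrong  : ∀ p q → lvP p ≡ lvP q → Star (SMStep (lvP p)) p q
      inLevels  : ∀ t p → 0 < pre t p →
                    lvP p ≡ lvT t ⊎ suc (toℕ (lvP p)) ≡ toℕ (lvT t)
      linked    : ∀ (i : Fin n) → 1 ≤ toℕ i → ∃₂ λ t p →
                    lvT t ≡ i × suc (toℕ (lvP p)) ≡ toℕ i × 0 < pre t p
      freeChoice : ∀ t t' p → lvT t ≡ lvT t' → lvP p ≡ lvT t →
                    0 < pre t p → 0 < pre t' p → ∀ q → pre t q ≡ pre t' q

  pot : Fin np → Fin np → ℕ
  pot p q =
    if ⌊ suc (toℕ (lvP q)) Data.Nat.≟ toℕ (lvP p) ⌋
    then fromMaybe0 (firstJust nt (λ t →
          if ⌊ lvT t ≟F lvP p ⌋ ∧ ⌊ 1 ≤? post t p ⌋ ∧ ⌊ 1 ≤? post t q ⌋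
          then just (post t q) else nothing))
    else 0

  potP : Fin np → ℕ
  potP p = sumF np (λ q → pot p q)

  maxPot : Fin n → ℕ
  maxPot i = maxSel np (λ p → ⌊ lvP p ≟F i ⌋) potP

  IsΠ3Net : Set
  IsΠ3Net = IsOrderedΠNet ×
    (∀ p t → suc (toℕ (lvP p)) ≡ toℕ (lvT t) → 0 < pre t p →
       potP p ≡ maxPot (lvP p))

  markOf : Marking → Fin n → ℕ
  markOf m i = sumF np (λ p → if ⌊ lvP p ≟F i ⌋ then lookup m p else 0)

  φ : Fin n → Marking → ℕ
  φ i m with minSel np (λ p → ⌊ lvP p ≟F i ⌋ ∧ ⌊ 1 ≤? lookup m p ⌋) potP
  ... | nothing = maxPot i
  ... | just v  = v

  NCondition : Marking → Set
  NCondition m =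
    (∀ (top : Fin n) → suc (toℕ top) ≡ n → 0 < markOf m top) ×
    (∀ (j q : Fin n) → suc (toℕ q) ≡ toℕ j → φ j m ≤ markOf m q)

  -- chainW j r p = Σ_{r_{j}, …, r_1} pot(r,r_j)·…·pot(r_2,r_1)·pot(r_1,p)
  -- i.e. the sum over chains of length j+1 ending at r (levels are forced
  -- by pot vanishing outside adjacent levels)
  chainW : ℕ → Fin np → Fin np → ℕ
  chainW zero    r p = pot r p
  chainW (suc j) r p = sumF np (λ r' → pot r r' * chainW j r' p)

  witness : (Fin np → ℤ) → Fin np → ℤ
  witness m p = m p ℤ.+
    sumZ (n ∸ suc (toℕ (lvP p))) (λ j →
      negPow (suc (toℕ j)) ℤ.*
        sumZ np (λ r → m r ℤ.* (+ chainW (toℕ j) r p)))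

  witnessOf : (Fin np → ℤ) → Fin n → ℤ
  witnessOf m i = sumZ np (λ p → if ⌊ lvP p ≟F i ⌋ then witness m p else + 0)

  toZ : Marking → Fin np → ℤ
  toZ m p = + lookup m p

  InS : Marking → Marking → Set
  InS m0 m = NCondition m × (∀ i → witnessOf (toZ m) i ≡ witnessOf (toZ m0) i)

{-# OPTIONS --safe #-}
-- Weak reversibility forces every transition to exchange complexes C p → C q with p, q on the same
-- level, where C p = p + Σ_q pot(p,q) q, and makes reachability symmetric.  The complexes C p form a
-- triangular basis whose coordinate map is the marking witness, so witness sums are invariant.
--
-- If the n-condition fails at level j, every marked place of level j asks for more tokens than level
-- j−1 holds.  Transitions of level j+1 only touch places of maximal potential, so this persists and
-- kills level j; a live marking therefore satisfies the n-condition.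
--
-- Conversely, under the n-condition one works from the bottom level upwards: one token of level j with
-- affordable potential is moved to a place of maximal potential, the tokens this frees pay for moving
-- all other tokens of level j there, and lower levels can then be redistributed at will.  The resulting
-- marking is determined, up to such redistribution, by its level sums, and these by the witness sums.
module Submission where

open import Defs
open import Data.Nat using (ℕ; zero; suc; _+_; _*_; _∸_; _≤_; _<_; _⊔_; _⊓_; z≤n; s≤s; z<s; _≤?_; _<?_; _≟_)
open import Data.Nat.Properties
open import Data.Bool using (true; false; if_then_else_; _∧_)
open import Data.Fin using (Fin; toℕ; fromℕ<) renaming (zero to fz; suc to fs; _≟_ to _≟F_)
open import Data.Fin.Properties using (toℕ-injective; toℕ<n; toℕ-fromℕ<; any?) renaming (suc-injective to fs-injective)
open import Data.Integer as ℤ using (ℤ)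
import Data.Integer.Properties as ℤ
open import Data.Integer.Tactic.RingSolver using (solve-∀)
open import Data.Maybe using (Maybe; just; nothing)
open import Data.Product using (∃; ∃₂; _×_; _,_; proj₁; proj₂)
open import Data.Sum using (_⊎_; inj₁; inj₂)
open import Data.Vec using (lookup; tabulate)
open import Data.Vec.Properties using (lookup∘tabulate; tabulate∘lookup; tabulate-cong)
open import Function using (_∘_)
open import Algebra.Properties.AbelianGroup ℤ.+-0-abelianGroup using (identityʳ-unique)
open import Algebra.Properties.CommutativeSemigroup +-commutativeSemigroup using (interchange)
open import Relation.Binary.Construct.Closure.ReflexiveTransitive using (Star; ε; _◅_; _◅◅_)
open import Relation.Binary.Construct.Closure.Symmetric using (bwd)
open import Relation.Binary.PropositionalEquality using (_≡_; _≢_; refl; sym; trans; cong; cong₂; subst; _≗_; module ≡-Reasoning)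
open import Relation.Nullary using (¬_; Dec; yes; no; contradiction)
open import Relation.Nullary.Decidable using (⌊_⌋; _×-dec_; ¬?)
open import Relation.Unary using (Decidable)

-- Finite sums, counts and induction on markings.

if-yes : ∀ {A P : Set} {a b : A} (P? : Dec P) → P → (if ⌊ P? ⌋ then a else b) ≡ a
if-yes (yes _) _ = refl
if-yes (no ¬p) p = contradiction p ¬p

if-no : ∀ {A P : Set} {a b : A} (P? : Dec P) → ¬ P → (if ⌊ P? ⌋ then a else b) ≡ b
if-no (yes p) ¬p = contradiction p ¬p
if-no (no _)  _  = refl

infixl 6 _⊕_

_⊕_ : ∀ {k} → (Fin k → ℕ) → (Fin k → ℕ) → Fin k → ℕ
(f ⊕ g) r = f r + g r

δ : ∀ {k} → Fin k → Fin k → ℕ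
δ p r = if ⌊ p ≟F r ⌋ then 1 else 0

δ-refl : ∀ {k} (p : Fin k) → δ p p ≡ 1
δ-refl p = if-yes (p ≟F p) refl

δ-≢ : ∀ {k} {p r : Fin k} → p ≢ r → δ p r ≡ 0
δ-≢ {p = p} {r} = if-no (p ≟F r)

δ-split : ∀ {k} (m : Fin k → ℕ) {p} → 0 < m p → δ p ⊕ (λ r → m r ∸ δ p r) ≗ m
δ-split m {p} 0<mp r with p ≟F r
... | yes refl = m+[n∸m]≡n 0<mp
... | no _     = refl

sumF-cong : ∀ k {f g : Fin k → ℕ} → f ≗ g → sumF k f ≡ sumF k g
sumF-cong zero    f≗g = refl
sumF-cong (suc k) f≗g = cong₂ _+_ (f≗g fz) (sumF-cong k (f≗g ∘ fs))

sumF-⊕ : ∀ k (f g : Fin k → ℕ) → sumF k (f ⊕ g) ≡ sumF k f + sumF k g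
sumF-⊕ zero    f g = refl
sumF-⊕ (suc k) f g =
  trans (cong (f fz + g fz +_) (sumF-⊕ k (f ∘ fs) (g ∘ fs)))
        (interchange (f fz) (g fz) (sumF k (f ∘ fs)) (sumF k (g ∘ fs)))

sumF-zero : ∀ k {f : Fin k → ℕ} → (∀ p → f p ≡ 0) → sumF k f ≡ 0
sumF-zero zero    f≡0 = refl
sumF-zero (suc k) f≡0 = cong₂ _+_ (f≡0 fz) (sumF-zero k (f≡0 ∘ fs))

sumF-only : ∀ k {f : Fin k → ℕ} q → (∀ p → p ≢ q → f p ≡ 0) → sumF k f ≡ f q
sumF-only (suc k) {f} fz     f≡0 =
  trans (cong (f fz +_) (sumF-zero k (λ p → f≡0 (fs p) (λ ())))) (+-identityʳ _)
sumF-only (suc k)     (fs q) f≡0 =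
  cong₂ _+_ (f≡0 fz (λ ())) (sumF-only k q (λ p p≢q → f≡0 (fs p) (p≢q ∘ fs-injective)))

term≤sumF : ∀ k {f : Fin k → ℕ} p → f p ≤ sumF k f
term≤sumF (suc k) fz     = m≤m+n _ _
term≤sumF (suc k) {f} (fs p) = ≤-trans (term≤sumF k p) (m≤n+m _ (f fz))

cnt : ∀ {k} {P : Fin k → Set} → Decidable P → (Fin k → ℕ) → ℕ
cnt {k} P? f = sumF k (λ p → if ⌊ P? p ⌋ then f p else 0)

module _ {k : ℕ} {P : Fin k → Set} (P? : Decidable P) where

  cnt-cong : ∀ {f g} → (∀ p → P p → f p ≡ g p) → cnt P? f ≡ cnt P? g
  cnt-cong {f} {g} eq = sumF-cong k pointwise
    where
    pointwise : ∀ p → (if ⌊ P? p ⌋ then f p else 0) ≡ (if ⌊ P? p ⌋ then g p else 0)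
    pointwise p with P? p
    ... | yes Pp = eq p Pp
    ... | no _   = refl

  cnt-⊕ : ∀ f g → cnt P? (f ⊕ g) ≡ cnt P? f + cnt P? g
  cnt-⊕ f g = trans (sumF-cong k pointwise) (sumF-⊕ k _ _)
    where
    pointwise : ∀ p → (if ⌊ P? p ⌋ then f p + g p else 0)
                    ≡ (if ⌊ P? p ⌋ then f p else 0) + (if ⌊ P? p ⌋ then g p else 0)
    pointwise p with P? p
    ... | yes _ = refl
    ... | no _  = refl

  cnt-none : ∀ {f} → (∀ p → P p → f p ≡ 0) → cnt P? f ≡ 0
  cnt-none eq = trans (cnt-cong eq) (sumF-zero k pointwise)
    where
    pointwise : ∀ p → (if ⌊ P? p ⌋ then 0 else 0) ≡ 0
    pointwise p with P? p
    ... | yes _ = refl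
    ... | no _  = refl

  cnt-all : ∀ {f} → (∀ p → ¬ P p → f p ≡ 0) → cnt P? f ≡ sumF k f
  cnt-all {f} eq = sumF-cong k pointwise
    where
    pointwise : ∀ p → (if ⌊ P? p ⌋ then f p else 0) ≡ f p
    pointwise p with P? p
    ... | yes _  = refl
    ... | no ¬Pp = sym (eq p ¬Pp)

  cnt-only : ∀ {f} q → P q → (∀ p → P p → p ≢ q → f p ≡ 0) → cnt P? f ≡ f q
  cnt-only {f} q Pq eq = trans (sumF-only k q pointwise) (if-yes (P? q) Pq)
    where
    pointwise : ∀ p → p ≢ q → (if ⌊ P? p ⌋ then f p else 0) ≡ 0
    pointwise p p≢q with P? p
    ... | yes Pp = eq p Pp p≢q
    ... | no _   = refl

  term≤cnt : ∀ {f} p → P p → f p ≤ cnt P? f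
  term≤cnt {f} p Pp = subst (_≤ cnt P? f) (if-yes (P? p) Pp)
    (term≤sumF k {λ q → if ⌊ P? q ⌋ then f q else 0} p)

  cnt-δ-in : ∀ {q} → P q → cnt P? (δ q) ≡ 1
  cnt-δ-in {q} Pq = trans (cnt-only q Pq (λ p _ p≢q → δ-≢ (p≢q ∘ sym))) (δ-refl q)

  cnt-δ-out : ∀ {q} → ¬ P q → cnt P? (δ q) ≡ 0
  cnt-δ-out ¬Pq = cnt-none (λ p Pp → δ-≢ λ { refl → ¬Pq Pp })

cnt-resp : ∀ {k} {P Q : Fin k → Set} (P? : Decidable P) (Q? : Decidable Q) {f : Fin k → ℕ} →
           (∀ p → P p → Q p) → (∀ p → Q p → P p) → cnt P? f ≡ cnt Q? f
cnt-resp {k} P? Q? {f} P⇒Q Q⇒P = sumF-cong k pointwise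
  where
  pointwise : ∀ p → (if ⌊ P? p ⌋ then f p else 0) ≡ (if ⌊ Q? p ⌋ then f p else 0)
  pointwise p with P? p
  ... | yes Pp = sym (if-yes (Q? p) (P⇒Q p Pp))
  ... | no ¬Pp = sym (if-no (Q? p) (¬Pp ∘ Q⇒P p))

-- One token is removed at a time, with the total number of tokens as measure. The hypothesis on
-- single tokens covers only places marked by `m`, so that properties of these places, such as
-- flatness, can be used. Closure under `≗` stands in for function extensionality.
marking-induction : ∀ {k} (Q : (Fin k → ℕ) → Set) →
  (∀ {f g} → f ≗ g → Q f → Q g) → Q (λ _ → 0) → (∀ {f g} → Q f → Q g → Q (f ⊕ g)) →
  ∀ m → (∀ r → 0 < m r → Q (δ r)) → Q m
marking-induction {k} Q resp Q0 Q⊕ m = go (sumF k m) m ≤-refl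
  where
  go : ∀ N m → sumF k m ≤ N → (∀ r → 0 < m r → Q (δ r)) → Q m
  go N m ∑m≤N Qδ with any? (λ r → 0 <? m r)
  ... | no ¬∃ = resp (λ r → sym (n≤0⇒n≡0 (≮⇒≥ λ 0<mr → ¬∃ (r , 0<mr)))) Q0
  go zero m ∑m≤N Qδ | yes (r , 0<mr) =
    contradiction (≤-trans 0<mr (≤-trans (term≤sumF k r) ∑m≤N)) λ ()
  go (suc N) m ∑m≤N Qδ | yes (r , 0<mr) =
    resp split (Q⊕ (Qδ r 0<mr) (go N x (≤-pred (subst (_≤ suc N) sum-split ∑m≤N))
      (λ s 0<xs → Qδ s (≤-trans 0<xs (m∸n≤m (m s) (δ r s))))))
    where
    x = λ s → m s ∸ δ r s
    split = δ-split m 0<mr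
    sum-split : sumF k m ≡ suc (sumF k x)
    sum-split = trans (sym (sumF-cong k split)) (trans (sumF-⊕ k (δ r) x)
      (cong (_+ sumF k x) (trans (sumF-only k r (λ p p≢r → δ-≢ (p≢r ∘ sym))) (δ-refl r))))

-- Extrema and searches over finite index sets.

≤-maxSel : ∀ k s (f : Fin k → ℕ) p → s p ≡ true → f p ≤ maxSel k s f
≤-maxSel (suc k) s f fz     sp rewrite sp = m≤m⊔n _ _
≤-maxSel (suc k) s f (fs p) sp = ≤-trans (≤-maxSel k _ _ p sp) (m≤n⊔m _ _)

-- The value 0 may be the default of `maxSel` rather than a value of `f`. In that case the given `p`
-- attains it, since `f p` ≤ 0.
maxSel-attained : ∀ k s (f : Fin k → ℕ) p → s p ≡ true → ∃ λ q → s q ≡ true × f q ≡ maxSel k s f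
maxSel-attained k s f p sp with bound k s f
  where
  bound : ∀ k s (f : Fin k → ℕ) → maxSel k s f ≡ 0 ⊎ ∃ λ q → s q ≡ true × f q ≡ maxSel k s f
  bound zero    s f = inj₁ refl
  bound (suc k) s f with s fz in s0 | bound k (s ∘ fs) (f ∘ fs)
  ... | false | inj₁ eq            = inj₁ eq
  ... | false | inj₂ (q , sq , eq) = inj₂ (fs q , sq , eq)
  ... | true  | inj₁ eq            = inj₂ (fz , s0 , sym (trans (cong (f fz ⊔_) eq) (⊔-identityʳ _)))
  ... | true  | inj₂ (q , sq , eq) with ≤-total (f fz) (maxSel k (s ∘ fs) (f ∘ fs))
  ...   | inj₁ ≤r = inj₂ (fs q , sq , trans eq (sym (m≤n⇒m⊔n≡n ≤r)))
  ...   | inj₂ ≥r = inj₂ (fz , s0 , sym (m≥n⇒m⊔n≡m ≥r))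
... | inj₂ found = found
... | inj₁ max≡0 = p , sp , trans (n≤0⇒n≡0 (subst (f p ≤_) max≡0 (≤-maxSel k s f p sp))) (sym max≡0)

minSel-nothing : ∀ k s (f : Fin k → ℕ) → minSel k s f ≡ nothing → ∀ p → s p ≡ false
minSel-nothing (suc k) s f eq p with s fz in s0
minSel-nothing (suc k) s f eq fz     | false = s0
minSel-nothing (suc k) s f eq (fs p) | false = minSel-nothing k _ _ eq p

minSel-just : ∀ k s (f : Fin k → ℕ) {v} → minSel k s f ≡ just v →
  (∃ λ p → s p ≡ true × f p ≡ v) × (∀ p → s p ≡ true → v ≤ f p)
minSel-just (suc k) s f eq with s fz in s0 | minSel k (s ∘ fs) (f ∘ fs) in rest
minSel-just (suc k) s f refl | false | just v with minSel-just k _ _ rest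
... | (p , sp , fp≡v) , v≤ = (fs p , sp , fp≡v) , λ { fz s0' → contradiction (trans (sym s0) s0') λ () ; (fs q) sq → v≤ q sq }
minSel-just (suc k) s f refl | true  | nothing =
  (fz , s0 , refl) , λ { fz _ → ≤-refl ; (fs q) sq → contradiction (trans (sym sq) (minSel-nothing k _ _ rest q)) λ () }
minSel-just (suc k) s f refl | true  | just v with minSel-just k _ _ rest
... | (p , sp , fp≡v) , v≤ = attained , λ { fz _ → m⊓n≤m _ _ ; (fs q) sq → ≤-trans (m⊓n≤n _ _) (v≤ q sq) }
  where
  attained : ∃ λ p → s p ≡ true × f p ≡ f fz ⊓ v
  attained with ≤-total (f fz) v
  ... | inj₁ ≤v = fz , s0 , sym (m≤n⇒m⊓n≡m ≤v)
  ... | inj₂ ≥v = fs p , sp , trans fp≡v (sym (m≥n⇒m⊓n≡n ≥v))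

firstJust-just : ∀ {A : Set} k (g : Fin k → Maybe A) {v} → firstJust k g ≡ just v → ∃ λ i → g i ≡ just v
firstJust-just (suc k) g eq with g fz in g0
firstJust-just (suc k) g refl | just v  = fz , g0
firstJust-just (suc k) g eq   | nothing with firstJust-just k (g ∘ fs) eq
... | i , gi = fs i , gi

firstJust-nothing : ∀ {A : Set} k (g : Fin k → Maybe A) → firstJust k g ≡ nothing → ∀ i → g i ≡ nothing
firstJust-nothing (suc k) g eq i with g fz in g0
firstJust-nothing (suc k) g eq fz     | nothing = g0
firstJust-nothing (suc k) g eq (fs i) | nothing = firstJust-nothing k (g ∘ fs) eq i

≯0⇒≡0 : ∀ {a} → ¬ 0 < a → a ≡ 0
≯0⇒≡0 ¬pos = n≤0⇒n≡0 (≮⇒≥ ¬pos)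

tabulate-injective : ∀ {k} {f g : Fin k → ℕ} → tabulate f ≡ tabulate g → f ≗ g
tabulate-injective {f = f} {g} eq r =
  trans (sym (lookup∘tabulate f r)) (trans (cong (λ v → lookup v r) eq) (lookup∘tabulate g r))

-- Input and output complexes of transitions; reversibility.

module Net (L : LNet) (Π³ : IsΠ3Net L) where
  open LNet L
  open IsOrderedΠNet (proj₁ Π³)

  lv : Fin np → ℕ
  lv p = toℕ (lvP p)

  pot-adjacent : ∀ {p q} → suc (lv q) ≡ lv p → pot L p q ≡ fromMaybe0 (firstJust nt (λ t →
          if ⌊ lvT t ≟F lvP p ⌋ ∧ ⌊ 1 ≤? post t p ⌋ ∧ ⌊ 1 ≤? post t q ⌋
          then just (post t q) else nothing))
  pot-adjacent {p} {q} = if-yes (suc (lv q) ≟ lv p)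

  pot-apart : ∀ {p q} → suc (lv q) ≢ lv p → pot L p q ≡ 0
  pot-apart {p} {q} = if-no (suc (lv q) ≟ lv p)

  pot-below : ∀ {p q} → 0 < pot L p q → suc (lv q) ≡ lv p
  pot-below {p} {q} 0<pot with suc (lv q) ≟ lv p
  ... | yes below = below

  -- `pot` takes its value from the first suitable transition, and only the outcome of that search
  -- is recorded here. That every other suitable transition gives the same value follows from
  -- `post≗C`.
  pot-spec : ∀ {p q} → suc (lv q) ≡ lv p →
    (pot L p q ≡ 0 × ∀ t → lvT t ≡ lvP p → 0 < post t p → post t q ≡ 0) ⊎
    (∃ λ t → lvT t ≡ lvP p × 0 < post t p × 0 < post t q × pot L p q ≡ post t q)
  pot-spec {p} {q} below = cases (firstJust nt g) refl
    where
    g : Fin nt → Maybe ℕ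
    g t = if ⌊ lvT t ≟F lvP p ⌋ ∧ ⌊ 1 ≤? post t p ⌋ ∧ ⌊ 1 ≤? post t q ⌋ then just (post t q) else nothing
    g-just : ∀ t {v} → g t ≡ just v → lvT t ≡ lvP p × 0 < post t p × 0 < post t q × v ≡ post t q
    g-just t eq with lvT t ≟F lvP p | 1 ≤? post t p | 1 ≤? post t q
    g-just t refl | yes a | yes b | yes c = a , b , c , refl
    g-nothing : ∀ t → g t ≡ nothing → lvT t ≡ lvP p → 0 < post t p → post t q ≡ 0
    g-nothing t eq same 0<p with lvT t ≟F lvP p | 1 ≤? post t p | 1 ≤? post t q
    ... | no ¬a | _ | _ = contradiction same ¬a
    ... | yes _ | no ¬b | _ = contradiction 0<p ¬b
    ... | yes _ | yes _ | no ¬c = ≯0⇒≡0 ¬c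
    cases : ∀ r → firstJust nt g ≡ r →
      (pot L p q ≡ 0 × ∀ t → lvT t ≡ lvP p → 0 < post t p → post t q ≡ 0) ⊎
      (∃ λ t → lvT t ≡ lvP p × 0 < post t p × 0 < post t q × pot L p q ≡ post t q)
    cases nothing eq = inj₁ (trans (pot-adjacent below) (cong fromMaybe0 eq) ,
      λ t → g-nothing t (firstJust-nothing nt g eq t))
    cases (just v) eq with firstJust-just nt g eq
    ... | t , gt with g-just t gt
    ...   | a , b , c , v≡ = inj₂ (t , a , b , c , trans (pot-adjacent below) (trans (cong fromMaybe0 eq) v≡))

  inP outP : Fin nt → Fin np
  inP t = proj₁ (smIn t)
  outP t = proj₁ (smOut t)

  inP-level : ∀ t → lvP (inP t) ≡ lvT t
  inP-level t = proj₁ (proj₂ (smIn t))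

  outP-level : ∀ t → lvP (outP t) ≡ lvT t
  outP-level t = proj₁ (proj₂ (smOut t))

  pre-inP : ∀ t → pre t (inP t) ≡ 1
  pre-inP t = proj₁ (proj₂ (proj₂ (smIn t)))

  post-outP : ∀ t → post t (outP t) ≡ 1
  post-outP t = proj₁ (proj₂ (proj₂ (smOut t)))

  inP-unique : ∀ t {q} → lvP q ≡ lvT t → 0 < pre t q → q ≡ inP t
  inP-unique t {q} same 0<pre with q ≟F inP t
  ... | yes eq = eq
  ... | no q≢  = contradiction (subst (0 <_) (proj₂ (proj₂ (proj₂ (smIn t))) q same q≢) 0<pre) λ ()

  outP-unique : ∀ t {q} → lvP q ≡ lvT t → 0 < post t q → q ≡ outP t
  outP-unique t {q} same 0<post with q ≟F outP t
  ... | yes eq = eq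
  ... | no q≢  = contradiction (subst (0 <_) (proj₂ (proj₂ (proj₂ (smOut t))) q same q≢) 0<post) λ ()

  input-level≤ : ∀ {t p} → 0 < pre t p → lv p ≤ toℕ (lvT t)
  input-level≤ {t} {p} 0<pre with inLevels t p 0<pre
  ... | inj₁ same  = ≤-reflexive (cong toℕ same)
  ... | inj₂ below = ≤-trans (n≤1+n _) (≤-reflexive below)

  -- The output place of `t` on its own level is an input place of `u`, and no input of `u` lies
  -- above the level of `u`.
  post≗pre⇒level≤ : ∀ {t u} → post t ≗ pre u → toℕ (lvT t) ≤ toℕ (lvT u)
  post≗pre⇒level≤ {t} {u} eq = subst (λ i → toℕ i ≤ toℕ (lvT u)) (outP-level t)
    (input-level≤ (≤-reflexive (trans (sym (post-outP t)) (eq (outP t)))))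

  pre≗pre⇒level≤ : ∀ {t u} → pre t ≗ pre u → toℕ (lvT t) ≤ toℕ (lvT u)
  pre≗pre⇒level≤ {t} {u} eq = subst (λ i → toℕ i ≤ toℕ (lvT u)) (inP-level t)
    (input-level≤ (≤-reflexive (trans (sym (pre-inP t)) (eq (inP t)))))

  -- Weak reversibility closes every arc into a cycle, and levels cannot decrease along arcs,
  -- so they are constant along paths.
  return-path : ∀ t → Star (Arc L) (tabulate (post t)) (tabulate (pre t))
  return-path t = weakRev _ _ (bwd (t , refl , refl) ◅ ε)

  path-source : ∀ {c t} → Star (Arc L) c (tabulate (pre t)) →
                ∃ λ u → c ≡ tabulate (pre u) × toℕ (lvT u) ≤ toℕ (lvT t)
  path-source {t = t} ε = t , refl , ≤-refl
  path-source ((u , c≡ , d≡) ◅ path) with path-source path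
  ... | v , d≡' , v≤t =
    u , c≡ , ≤-trans (post≗pre⇒level≤ (tabulate-injective (trans (sym d≡) d≡'))) v≤t

  path-target : ∀ {c d} → Star (Arc L) c d → c ≡ d ⊎ ∃ λ u → d ≡ tabulate (post u)
  path-target ε = inj₁ refl
  path-target ((u , _ , d≡) ◅ path) with path-target path
  ... | inj₁ refl  = inj₂ (u , d≡)
  ... | inj₂ found = inj₂ found

  -- The first transition `u` of the return path (`t` itself if the path is empty) consumes
  -- `post t`. Levels never decrease along the path, which ends at `pre t`, so `u` is not above `t`;
  -- `post≗pre⇒level≤` gives the other inequality.
  post-is-pre : ∀ t → ∃ λ u → lvT u ≡ lvT t × post t ≗ pre u
  post-is-pre t with path-source (return-path t)
  ... | u , eq , u≤t = u , toℕ-injective (≤-antisym u≤t (post≗pre⇒level≤ post≗pre)) , post≗pre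
    where post≗pre = tabulate-injective eq

  -- The last transition `u` of the return path produces `pre t`. Its level is compared with that of
  -- `t` through a `v` that consumes the same complex: equal inputs bound the levels in both
  -- directions, whereas `post u ≗ pre t` bounds them in only one.
  pre-is-post : ∀ t → ∃ λ u → lvT u ≡ lvT t × post u ≗ pre t
  pre-is-post t with path-target (return-path t)
  ... | inj₁ eq = t , refl , tabulate-injective eq
  ... | inj₂ (u , eq) with post-is-pre u
  ...   | v , v≡u , post≗pre = u , trans (sym v≡u) (toℕ-injective (≤-antisym (pre≗pre⇒level≤ v≗t)
                                     (pre≗pre⇒level≤ (sym ∘ v≗t)))) , u≗t
    where
    u≗t : post u ≗ pre t
    u≗t = tabulate-injective (sym eq)
    v≗t : pre v ≗ pre t
    v≗t r = trans (sym (post≗pre r)) (u≗t r)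

  -- By free choice, all inputs and outputs of transitions have this form.
  C : Fin np → Fin np → ℕ
  C p = δ p ⊕ pot L p

  -- The work lies in the places directly below `inP t`. If the search behind `pot` finds a producer
  -- `u` of `inP t`, then `post u` is the input of some `v` that shares `inP t` with `t`, and free
  -- choice equates `pre v` with `pre t`. If it finds none, a transition that produces `pre t` shows
  -- that the weight is 0.
  pre≗C : ∀ t → pre t ≗ C (inP t)
  pre≗C t r = cases (suc (lv r) ≟ lv (inP t)) (r ≟F inP t)
    where
    no-input : suc (lv r) ≢ lv (inP t) → r ≢ inP t → ¬ 0 < pre t r
    no-input apart r≢ 0<pre with inLevels t r 0<pre
    ... | inj₁ same  = r≢ (inP-unique t same 0<pre)
    ... | inj₂ below = apart (trans below (cong toℕ (sym (inP-level t))))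
    pot≡pre : suc (lv r) ≡ lv (inP t) → pot L (inP t) r ≡ pre t r
    pot≡pre below with pot-spec below
    ... | inj₁ (pot≡0 , none) with pre-is-post t
    ...   | u , u≡t , post≗pre = trans pot≡0 (sym (trans (sym (post≗pre r))
              (none u (trans u≡t (sym (inP-level t))) (≤-reflexive (sym (trans (post≗pre (inP t)) (pre-inP t)))))))
    pot≡pre below | inj₂ (u , u≡ , 0<out , _ , pot≡) with post-is-pre u
    ...   | v , v≡u , post≗pre = trans pot≡ (trans (post≗pre r) (freeChoice v t (inP t)
              (trans v≡u (trans u≡ (inP-level t))) (trans (sym u≡) (sym v≡u))
              (subst (0 <_) (post≗pre (inP t)) 0<out) (≤-reflexive (sym (pre-inP t))) r))
    cases : Dec (suc (lv r) ≡ lv (inP t)) → Dec (r ≡ inP t) → pre t r ≡ C (inP t) r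
    cases (yes below) _ = trans (sym (pot≡pre below)) (cong (_+ pot L (inP t) r)
      (sym (δ-≢ λ eq → 1+n≢n (trans below (cong lv eq)))))
    cases (no apart) (yes refl) = trans (pre-inP t) (sym (cong₂ _+_ (δ-refl r) (pot-apart apart)))
    cases (no apart) (no r≢) =
      trans (≯0⇒≡0 (no-input apart r≢)) (sym (cong₂ _+_ (δ-≢ (r≢ ∘ sym)) (pot-apart apart)))

  -- `post t` is the input of a transition of the same level, whose input place on that level can
  -- only be `outP t`.
  post≗C : ∀ t → post t ≗ C (outP t)
  post≗C t r with post-is-pre t
  ... | u , u≡t , post≗pre = trans (post≗pre r) (trans (pre≗C u r) (cong (λ p → C p r) (sym same)))
    where
    same : outP t ≡ inP u
    same = inP-unique u (trans (outP-level t) (sym u≡t))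
      (≤-reflexive (trans (sym (post-outP t)) (post≗pre (outP t))))

  -- The Π³ condition enters here: a place `q` with `pot L p q` positive is an output, hence by
  -- `post-is-pre` an input, of a transition one level above it.
  pot-flat : ∀ {p q} → 0 < pot L p q → potP L q ≡ maxPot L (lvP q)
  pot-flat {p} {q} 0<pot with pot-spec (pot-below 0<pot)
  ... | inj₁ (pot≡0 , _) = contradiction (subst (0 <_) pot≡0 0<pot) λ ()
  ... | inj₂ (t , t≡ , _ , 0<post , _) with post-is-pre t
  ...   | u , u≡t , post≗pre = proj₂ Π³ q u
            (trans (pot-below 0<pot) (cong toℕ (sym (trans u≡t t≡)))) (subst (0 <_) (post≗pre q) 0<post)

  infix 4 _⇝_

  -- Markings are handled as functions up to `≗`; tabulating turns pointwise equality into equality,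
  -- so no extensionality is required.
  _⇝_ : (Fin np → ℕ) → (Fin np → ℕ) → Set
  f ⇝ g = Reach L (tabulate f) (tabulate g)

  ⇝-resp : ∀ {f f′ g g′} → f ≗ f′ → g ≗ g′ → f ⇝ g → f′ ⇝ g′
  ⇝-resp f≗ g≗ rewrite tabulate-cong f≗ | tabulate-cong g≗ = λ path → path

  ⇝-refl : ∀ {f g} → f ≗ g → f ⇝ g
  ⇝-refl f≗g = ⇝-resp (λ _ → refl) f≗g ε

  fire-in-context : ∀ t x → pre t ⊕ x ⇝ post t ⊕ x
  fire-in-context t x = (t , enabled , tabulate-cong after) ◅ ε
    where
    enabled : Enabled L (tabulate (pre t ⊕ x)) t
    enabled p = subst (pre t p ≤_) (sym (lookup∘tabulate (pre t ⊕ x) p)) (m≤m+n _ _)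
    after : ∀ p → post t p + x p ≡ lookup (tabulate (pre t ⊕ x)) p ∸ pre t p + post t p
    after p = sym (trans (cong (λ v → v ∸ pre t p + post t p) (lookup∘tabulate (pre t ⊕ x) p))
      (trans (cong (_+ post t p) (m+n∸m≡n (pre t p) (x p))) (+-comm (x p) (post t p))))

  -- Strong connectivity gives a path of transitions from `p` to `q`. Each consumes exactly the
  -- complex produced by the one before, so the context `x` is never touched.
  exchange : ∀ {p q} → lvP p ≡ lvP q → ∀ x → C p ⊕ x ⇝ C q ⊕ x
  exchange {p} {q} same x = along (smStrong p q same)
    where
    along : ∀ {i p q} → Star (SMStep L i) p q → C p ⊕ x ⇝ C q ⊕ x
    along ε = ε
    along ((t , t≡i , p≡i , q≡i , 0<pre , 0<post) ◅ path)
      with refl ← inP-unique t (trans p≡i (sym t≡i)) 0<pre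
         | refl ← outP-unique t (trans q≡i (sym t≡i)) 0<post =
      ⇝-resp (λ r → cong (_+ x r) (pre≗C t r)) (λ r → cong (_+ x r) (post≗C t r))
        (fire-in-context t x) ◅◅ along path

  step-shape : ∀ {m m′} (step : Step L m m′) → ∃₂ λ p q → ∃ λ x →
    lvP p ≡ lvT (proj₁ step) × lvP p ≡ lvP q × lookup m ≗ C p ⊕ x × lookup m′ ≗ C q ⊕ x
  step-shape {m} (t , enabled , refl) =
    inP t , outP t , x , inP-level t , trans (inP-level t) (sym (outP-level t)) , before , after
    where
    x : Fin np → ℕ
    x r = lookup m r ∸ pre t r
    before : lookup m ≗ C (inP t) ⊕ x
    before r = trans (sym (m+[n∸m]≡n (enabled r))) (cong (_+ x r) (pre≗C t r))
    after : lookup (fire L m t) ≗ C (outP t) ⊕ x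
    after r = trans (lookup∘tabulate _ r) (trans (+-comm (x r) (post t r)) (cong (_+ x r) (post≗C t r)))

  -- Firing trades `C p` for `C q` on one level, and `exchange` also leads from `q` back to `p`.
  step-reversible : ∀ {m m′} → Step L m m′ → Reach L m′ m
  step-reversible {m} {m′} step with step-shape {m} {m′} step
  ... | p , q , x , _ , same , before , after =
    subst (λ v → Reach L v m) (tabulate∘lookup m′)
      (subst (Reach L (tabulate (lookup m′))) (tabulate∘lookup m)
        (⇝-resp (sym ∘ after) (sym ∘ before) (exchange (sym same) x)))

  Reach-sym : ∀ {m m′} → Reach L m m′ → Reach L m′ m
  Reach-sym ε = ε
  Reach-sym (_◅_ {m} {m′} step path) = Reach-sym path ◅◅ step-reversible {m} {m′} step

-- Level sums, flat and rich markings, refilling a level.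

⌊⌋-true : ∀ {P : Set} (P? : Dec P) → P → ⌊ P? ⌋ ≡ true
⌊⌋-true (yes _) _ = refl
⌊⌋-true (no ¬p) p = contradiction p ¬p

true-⌊⌋ : ∀ {P : Set} (P? : Dec P) → ⌊ P? ⌋ ≡ true → P
true-⌊⌋ (yes p) _ = p

0<+⇒ : ∀ a {b} → 0 < a + b → 0 < a ⊎ 0 < b
0<+⇒ zero    0<b = inj₂ 0<b
0<+⇒ (suc a) _   = inj₁ z<s

module Move (L : LNet) (Π³ : IsΠ3Net L) where
  open LNet L
  open IsOrderedΠNet (proj₁ Π³)
  open Net L Π³

  M : (Fin np → ℕ) → ℕ → ℕ
  M m l = cnt (λ p → lv p ≟ l) m

  -- The number of tokens one level below k (none if k is the bottom level 0).
  LM : (Fin np → ℕ) → ℕ → ℕ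
  LM m k = cnt (λ p → suc (lv p) ≟ k) m

  M-⊕ : ∀ f g l → M (f ⊕ g) l ≡ M f l + M g l
  M-⊕ f g l = cnt-⊕ (λ p → lv p ≟ l) f g

  LM-⊕ : ∀ f g k → LM (f ⊕ g) k ≡ LM f k + LM g k
  LM-⊕ f g k = cnt-⊕ (λ p → suc (lv p) ≟ k) f g

  M-cong : ∀ {f g} → f ≗ g → ∀ l → M f l ≡ M g l
  M-cong f≗g l = cnt-cong (λ p → lv p ≟ l) (λ p _ → f≗g p)

  LM-cong : ∀ {f g} → f ≗ g → ∀ k → LM f k ≡ LM g k
  LM-cong f≗g k = cnt-cong (λ p → suc (lv p) ≟ k) (λ p _ → f≗g p)

  LM-suc : ∀ m l → LM m (suc l) ≡ M m l
  LM-suc m l = cnt-resp (λ p → suc (lv p) ≟ suc l) (λ p → lv p ≟ l) (λ _ → suc-injective) (λ _ → cong suc)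

  LM-zero : ∀ m → LM m 0 ≡ 0
  LM-zero m = cnt-none (λ p → suc (lv p) ≟ 0) {m} (λ _ ())

  LM-δ : ∀ {p k} → suc (lv p) ≢ k → LM (δ p) k ≡ 0
  LM-δ {k = k} = cnt-δ-out (λ p → suc (lv p) ≟ k)

  M-δ : ∀ {p q} → lv p ≡ lv q → ∀ l → M (δ p) l ≡ M (δ q) l
  M-δ {p} {q} same l with lv p ≟ l
  ... | yes p≡l = trans (cnt-δ-in (λ p → lv p ≟ l) p≡l) (sym (cnt-δ-in (λ p → lv p ≟ l) (trans (sym same) p≡l)))
  ... | no p≢l  = trans (cnt-δ-out (λ p → lv p ≟ l) p≢l)
                    (sym (cnt-δ-out (λ p → lv p ≟ l) (p≢l ∘ trans same)))

  LM-pot : ∀ {p k} → lv p ≡ k → LM (pot L p) k ≡ potP L p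
  LM-pot {p} refl = cnt-all (λ q → suc (lv q) ≟ lv p) (λ q → pot-apart)

  M-pot : ∀ {p l} → suc l ≡ lv p → M (pot L p) l ≡ potP L p
  M-pot {p} {l} eq = trans (sym (LM-suc (pot L p) l)) (LM-pot (sym eq))

  M-pot-apart : ∀ {p l} → suc l ≢ lv p → M (pot L p) l ≡ 0
  M-pot-apart {l = l} apart = cnt-none (λ q → lv q ≟ l) (λ q q≡l → pot-apart (apart ∘ trans (cong suc (sym q≡l))))

  potP≤maxPot : ∀ p → potP L p ≤ maxPot L (lvP p)
  potP≤maxPot p = ≤-maxSel np (λ q → ⌊ lvP q ≟F lvP p ⌋) (potP L) p (⌊⌋-true (lvP p ≟F lvP p) refl)

  potP-bottom : ∀ {p} → lv p ≡ 0 → potP L p ≡ 0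
  potP-bottom p≡0 = sumF-zero np (λ q → pot-apart (λ below → 1+n≢0 (trans below p≡0)))

  star-spec : ∀ i → ∃ λ s → lvP s ≡ i × potP L s ≡ maxPot L i
  star-spec i with nonEmpty i
  ... | p , p≡i with maxSel-attained np (λ q → ⌊ lvP q ≟F i ⌋) (potP L) p (⌊⌋-true (lvP p ≟F i) p≡i)
  ...   | s , s-in , s-max = s , true-⌊⌋ (lvP s ≟F i) s-in , s-max

  -- The chosen place of maximal potential, on which each level is collected.
  star : Fin n → Fin np
  star i = proj₁ (star-spec i)

  star-level : ∀ i → lvP (star i) ≡ i
  star-level i = proj₁ (proj₂ (star-spec i))

  star-max : ∀ i → potP L (star i) ≡ maxPot L i
  star-max i = proj₂ (proj₂ (star-spec i))

  -- Below level k, a flat and rich marking holds enough tokens, on interchangeable places, to fire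
  -- any transition of these levels after redistributing the levels beneath it.
  Flat : ℕ → (Fin np → ℕ) → Set
  Flat k m = ∀ r → lv r < k → 0 < m r → potP L r ≡ maxPot L (lvP r)

  Rich : ℕ → (Fin np → ℕ) → Set
  Rich k m = ∀ i → toℕ i < k → maxPot L i ≤ LM m (toℕ i)

  Rearrangeable : ℕ → Set
  Rearrangeable k = ∀ {m m′} → Flat k m → Flat k m′ → Rich k m →
    (∀ r → k ≤ lv r → m r ≡ m′ r) → (∀ l → l < k → M m l ≡ M m′ l) → m ⇝ m′

  Flat-⊕ : ∀ {k f g} → Flat k f → Flat k g → Flat k (f ⊕ g)
  Flat-⊕ {f = f} flat-f flat-g r r<k 0<+ with 0<+⇒ (f r) 0<+
  ... | inj₁ 0<f = flat-f r r<k 0<f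
  ... | inj₂ 0<g = flat-g r r<k 0<g

  Flat-δ : ∀ {k q} → k ≤ lv q → Flat k (δ q)
  Flat-δ {q = q} k≤q r r<k 0<δ with q ≟F r
  ... | yes refl = contradiction r<k (≤⇒≯ k≤q)

  Flat-pot : ∀ {k} q → Flat k (pot L q)
  Flat-pot q r _ = pot-flat

  Flat-≤ : ∀ {k f g} → (∀ r → f r ≤ g r) → Flat k g → Flat k f
  Flat-≤ f≤g flat r r<k 0<f = flat r r<k (≤-trans 0<f (f≤g r))

  Rich-≤ : ∀ {k f g} → (∀ j → j < k → LM f j ≤ LM g j) → Rich k f → Rich k g
  Rich-≤ LM≤ rich i i<k = ≤-trans (rich i i<k) (LM≤ (toℕ i) i<k)

  LM-⊕-≤ˡ : ∀ f g j → LM f j ≤ LM (f ⊕ g) j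
  LM-⊕-≤ˡ f g j = ≤-trans (m≤m+n _ _) (≤-reflexive (sym (LM-⊕ f g j)))

  LM-⊕-≤ʳ : ∀ f g j → LM g j ≤ LM (f ⊕ g) j
  LM-⊕-≤ʳ f g j = ≤-trans (m≤n+m _ (LM f j)) (≤-reflexive (sym (LM-⊕ f g j)))

  heap : ℕ → ℕ → Fin np → ℕ
  heap k d r = if ⌊ (suc (lv r) ≟ k) ×-dec (star (lvP r) ≟F r) ⌋ then d else 0

  heap-apart : ∀ {k d r} → suc (lv r) ≢ k → heap k d r ≡ 0
  heap-apart {k} {r = r} apart = if-no ((suc (lv r) ≟ k) ×-dec (star (lvP r) ≟F r)) (apart ∘ proj₁)

  heap-empty : ∀ k r → heap k 0 r ≡ 0
  heap-empty k r with (suc (lv r) ≟ k) ×-dec (star (lvP r) ≟F r)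
  ... | yes _ = refl
  ... | no _  = refl

  Flat-heap : ∀ {j} k d → Flat j (heap k d)
  Flat-heap k d r _ 0<heap with (suc (lv r) ≟ k) ×-dec (star (lvP r) ≟F r)
  ... | yes (_ , eq) = subst (λ s → potP L s ≡ maxPot L (lvP r)) eq (star-max (lvP r))

  M-heap : ∀ {k l} d → l < n → suc l ≡ k → M (heap k d) l ≡ d
  M-heap {k} {l} d l<n eq = trans (cnt-only (λ p → lv p ≟ l) (star i) at-l elsewhere) at-star
    where
    i : Fin n
    i = fromℕ< l<n
    at-l : lv (star i) ≡ l
    at-l = trans (cong toℕ (star-level i)) (toℕ-fromℕ< l<n)
    elsewhere : ∀ p → lv p ≡ l → p ≢ star i → heap k d p ≡ 0
    elsewhere p p≡l p≢ = if-no ((suc (lv p) ≟ k) ×-dec (star (lvP p) ≟F p))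
      (λ { (_ , eq′) → p≢ (trans (sym eq′) (cong star (toℕ-injective (trans p≡l (sym (toℕ-fromℕ< l<n)))))) })
    at-star : heap k d (star i) ≡ d
    at-star = if-yes ((suc (lv (star i)) ≟ k) ×-dec (star (lvP (star i)) ≟F star i))
      (trans (cong suc at-l) eq , cong star (star-level i))

  M-heap-apart : ∀ {k l d} → suc l ≢ k → M (heap k d) l ≡ 0
  M-heap-apart {l = l} apart = cnt-none (λ p → lv p ≟ l) (λ p p≡l → heap-apart (apart ∘ trans (cong suc (sym p≡l))))

  LM-heap : ∀ {k d} → k ≤ n → (k ≡ 0 → d ≡ 0) → LM (heap k d) k ≡ d
  LM-heap {zero}  {d} _   d≡0 = trans (LM-zero (heap zero d)) (sym (d≡0 refl))
  LM-heap {suc l} {d} l<n _   = trans (LM-suc (heap (suc l) d) l) (M-heap d l<n refl)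

  clear : ℕ → (Fin np → ℕ) → Fin np → ℕ
  clear k x r = if ⌊ suc (lv r) ≟ k ⌋ then 0 else x r

  clear-≤ : ∀ k x r → clear k x r ≤ x r
  clear-≤ k x r with suc (lv r) ≟ k
  ... | yes _ = z≤n
  ... | no _  = ≤-refl

  clear-apart : ∀ {k x r} → suc (lv r) ≢ k → clear k x r ≡ x r
  clear-apart {k} {r = r} = if-no (suc (lv r) ≟ k)

  M-clear : ∀ {k l} x → suc l ≡ k → M (clear k x) l ≡ 0
  M-clear {k} {l} x eq = cnt-none (λ p → lv p ≟ l) (λ p p≡l → if-yes (suc (lv p) ≟ k) (trans (cong suc p≡l) eq))

  M-clear-apart : ∀ {k l} x → suc l ≢ k → M (clear k x) l ≡ M x l
  M-clear-apart {k} {l} x apart =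
    cnt-cong (λ p → lv p ≟ l) (λ p p≡l → clear-apart {x = x} (apart ∘ trans (cong suc (sym p≡l))))

  -- Puts the input of a transition leaving q in place: level k−1 of δ q ⊕ x ⊕ heap k d, which the
  -- clearing discards, is redistributed as pot q plus e spare tokens.
  refill : ∀ {k q x d e} → Rearrangeable k → lv q ≡ k → Flat k x → Rich k x →
    potP L q + e ≡ LM x k + d → δ q ⊕ x ⊕ heap k d ⇝ C q ⊕ (clear k x ⊕ heap k e)
  refill {k} {q} {x} {d} {e} rearrange q≡k flat rich balance = rearrange
    (Flat-⊕ (Flat-⊕ Flat-δq flat) (Flat-heap k d))
    (Flat-⊕ (Flat-⊕ Flat-δq (Flat-pot q)) (Flat-⊕ (Flat-≤ (clear-≤ k x) flat) (Flat-heap k e)))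
    (Rich-≤ (λ j _ → ≤-trans (LM-⊕-≤ʳ (δ q) x j) (LM-⊕-≤ˡ (δ q ⊕ x) (heap k d) j)) rich)
    above counts
    where
    Flat-δq : Flat k (δ q)
    Flat-δq = Flat-δ (≤-reflexive (sym q≡k))
    above : ∀ r → k ≤ lv r → (δ q ⊕ x ⊕ heap k d) r ≡ (C q ⊕ (clear k x ⊕ heap k e)) r
    above r k≤r = trans
      (cong₂ _+_ (cong₂ _+_ δ≡C x≡clear) (trans (heap-apart {d = d} apart) (sym (heap-apart {d = e} apart))))
      (+-assoc (C q r) (clear k x r) (heap k e r))
      where
      apart : suc (lv r) ≢ k
      apart eq = <-irrefl (sym eq) (s≤s k≤r)
      x≡clear : x r ≡ clear k x r
      x≡clear = sym (clear-apart {x = x} apart)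
      δ≡C : δ q r ≡ C q r
      δ≡C = sym (trans (cong (δ q r +_) (pot-apart (λ below → apart (trans below q≡k)))) (+-identityʳ _))
    M-lhs : ∀ l → M (δ q ⊕ x ⊕ heap k d) l ≡ M (δ q) l + (M x l + M (heap k d) l)
    M-lhs l = trans (M-⊕ (δ q ⊕ x) (heap k d) l)
      (trans (cong (_+ M (heap k d) l) (M-⊕ (δ q) x l)) (+-assoc (M (δ q) l) _ _))
    M-rhs : ∀ l → M (C q ⊕ (clear k x ⊕ heap k e)) l
                ≡ M (δ q) l + (M (pot L q) l + (M (clear k x) l + M (heap k e) l))
    M-rhs l = trans (M-⊕ (C q) _ l)
      (trans (cong₂ _+_ (M-⊕ (δ q) (pot L q) l) (M-⊕ (clear k x) (heap k e) l)) (+-assoc (M (δ q) l) _ _))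
    balanced : ∀ l → Dec (suc l ≡ k) →
      M x l + M (heap k d) l ≡ M (pot L q) l + (M (clear k x) l + M (heap k e) l)
    balanced l (yes eq) = trans (cong₂ _+_ M≡LM (M-heap d l<n eq)) (trans (sym balance)
        (sym (cong₂ _+_ (M-pot (trans eq (sym q≡k))) (cong₂ _+_ (M-clear x eq) (M-heap e l<n eq)))))
      where
      M≡LM : M x l ≡ LM x k
      M≡LM = trans (sym (LM-suc x l)) (cong (LM x) eq)
      l<n : l < n
      l<n = ≤-trans (≤-reflexive (trans eq (sym q≡k))) (<⇒≤ (toℕ<n (lvP q)))
    balanced l (no apart) = trans (cong (M x l +_) (M-heap-apart apart))
      (sym (cong₂ _+_ (M-pot-apart (λ eq → apart (trans eq q≡k)))
        (cong₂ _+_ (M-clear-apart x apart) (M-heap-apart apart))))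
    counts : ∀ l → l < k → M (δ q ⊕ x ⊕ heap k d) l ≡ M (C q ⊕ (clear k x ⊕ heap k e)) l
    counts l _ = trans (M-lhs l) (trans (cong (M (δ q) l +_) (balanced l (suc l ≟ k))) (sym (M-rhs l)))

  -- Three moves: `refill` assembles the input complex of `p`, `exchange` turns it into that of the
  -- chosen place, and `refill` run backwards dissolves the latter into loose tokens. This restores
  -- `x` and leaves the difference of the two potentials on the heap.
  raise : ∀ {k p x} → Rearrangeable k → lv p ≡ k → Flat k x → Rich k x → potP L p ≤ LM x k →
    δ p ⊕ x ⇝ δ (star (lvP p)) ⊕ x ⊕ heap k (maxPot L (lvP p) ∸ potP L p)
  raise {k} {p} {x} rearrange p≡k flat rich enough =
    ⇝-resp (λ r → trans (cong ((δ p ⊕ x) r +_) (heap-empty k r)) (+-identityʳ _)) (λ _ → refl)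
      (refill rearrange p≡k flat rich (trans (m+[n∸m]≡n enough) (sym (+-identityʳ _)))
       ◅◅ exchange (sym (star-level (lvP p))) _
       ◅◅ Reach-sym (refill rearrange (trans (cong toℕ (star-level (lvP p))) p≡k) flat rich balance))
    where
    open ≡-Reasoning
    balance : potP L (star (lvP p)) + (LM x k ∸ potP L p) ≡ LM x k + (maxPot L (lvP p) ∸ potP L p)
    balance = begin
      potP L (star (lvP p)) + (LM x k ∸ potP L p) ≡⟨ cong (_+ (LM x k ∸ potP L p)) (star-max (lvP p)) ⟩
      maxPot L (lvP p) + (LM x k ∸ potP L p)      ≡⟨ +-∸-assoc (maxPot L (lvP p)) enough ⟨
      maxPot L (lvP p) + LM x k ∸ potP L p        ≡⟨ cong (_∸ potP L p) (+-comm (maxPot L (lvP p)) (LM x k)) ⟩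
      LM x k + maxPot L (lvP p) ∸ potP L p        ≡⟨ +-∸-assoc (LM x k) (potP≤maxPot p) ⟩
      LM x k + (maxPot L (lvP p) ∸ potP L p)      ∎

  -- Gathering a level on its chosen place; rearrangement.

  detach : (Fin np → ℕ) → Fin np → Fin np → ℕ
  detach m p r = m r ∸ δ p r

  Flat-detach : ∀ {k m p} → Flat k m → Flat k (detach m p)
  Flat-detach {m = m} {p} = Flat-≤ (λ r → m∸n≤m (m r) (δ p r))

  LM-detach : ∀ {m p j} → 0 < m p → j ≤ lv p → LM m j ≡ LM (detach m p) j
  LM-detach {m} {p} {j} 0<mp j≤p = trans (sym (LM-cong (δ-split m 0<mp) j))
    (trans (LM-⊕ (δ p) (detach m p) j) (cong (_+ LM (detach m p) j)
      (LM-δ (λ eq → <-irrefl (sym eq) (s≤s j≤p)))))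

  Rich-detach : ∀ {k m p} → 0 < m p → k ≤ suc (lv p) → Rich k m → Rich k (detach m p)
  Rich-detach 0<mp k≤ = Rich-≤ (λ j j<k → ≤-reflexive (LM-detach 0<mp (≤-pred (≤-trans j<k k≤))))

  module _ (i : Fin n) where

    private k = toℕ i

    -- `counts` is conditional because raising a token from a place of smaller potential releases
    -- tokens one level below. If level `k` is flat already, nothing is released.
    record Gathered (m g : Fin np → ℕ) : Set where
      field
        reach  : m ⇝ g
        flat   : Flat k g
        rich   : Rich (suc k) g
        above  : ∀ r → k < lv r → g r ≡ m r
        level  : M g k ≡ M m k
        alone  : ∀ r → lvP r ≡ i → r ≢ star i → g r ≡ 0
        counts : Flat (suc k) m → ∀ l → M g l ≡ M m l

    open Gathered

    Stray : Fin np → Set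
    Stray r = lvP r ≡ i × star i ≢ r

    stray? : Decidable Stray
    stray? r = (lvP r ≟F i) ×-dec ¬? (star i ≟F r)

    raised : (Fin np → ℕ) → Fin np → Fin np → ℕ
    raised m p = δ (star i) ⊕ detach m p ⊕ heap k (maxPot L i ∸ potP L p)

    module _ {m : Fin np → ℕ} {p : Fin np} (p≡i : lvP p ≡ i) (0<mp : 0 < m p) where

      private
        x = detach m p
        d = maxPot L i ∸ potP L p
        p≡k : lv p ≡ k
        p≡k = cong toℕ p≡i
        star≡k : lv (star i) ≡ k
        star≡k = cong toℕ (star-level i)
        heap≡0 : ∀ r → k ≤ lv r → heap k d r ≡ 0
        heap≡0 r k≤r = heap-apart (λ eq → <-irrefl (sym eq) (s≤s k≤r))

      raised-reach : Rearrangeable k → Flat k m → Rich k m → potP L p ≤ LM m k → m ⇝ raised m p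
      raised-reach rearrange flat-m rich-m enough =
        subst (λ j → m ⇝ δ (star j) ⊕ x ⊕ heap k (maxPot L j ∸ potP L p)) p≡i
          (⇝-resp (δ-split m 0<mp) (λ _ → refl)
            (raise rearrange p≡k (Flat-detach {p = p} flat-m)
              (Rich-detach {p = p} 0<mp (≤-trans (≤-reflexive (sym p≡k)) (n≤1+n _)) rich-m)
              (≤-trans enough (≤-reflexive (LM-detach {p = p} 0<mp (≤-reflexive (sym p≡k)))))))

      raised-flat : ∀ {j} → Flat j m → Flat j (raised m p)
      raised-flat flat-m = Flat-⊕ (Flat-⊕ Flat-star (Flat-detach {p = p} flat-m)) (Flat-heap k d)
        where
        Flat-star : ∀ {j} → Flat j (δ (star i))
        Flat-star r _ 0<δ with star i ≟F r
        ... | yes refl = trans (star-max i) (cong (maxPot L) (sym (star-level i)))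

      raised-LM : ∀ j → j ≤ k → LM m j + LM (heap k d) j ≡ LM (raised m p) j
      raised-LM j j≤k = sym (trans (LM-⊕ (δ (star i) ⊕ x) (heap k d) j) (cong (_+ LM (heap k d) j)
        (trans (LM-⊕ (δ (star i)) x j) (trans (cong (_+ LM x j) star≡0)
          (sym (LM-detach 0<mp (≤-trans j≤k (≤-reflexive (sym p≡k)))))))))
        where
        star≡0 : LM (δ (star i)) j ≡ 0
        star≡0 = LM-δ (λ eq → <-irrefl (trans (sym eq) (cong suc star≡k)) (s≤s j≤k))

      raised-rich : ∀ {j} → j ≤ suc k → Rich j m → Rich j (raised m p)
      raised-rich j≤ = Rich-≤ (λ l l<j →
        ≤-trans (m≤m+n _ _) (≤-reflexive (raised-LM l (≤-pred (≤-trans l<j j≤)))))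

      raised-above : ∀ r → k < lv r → raised m p r ≡ m r
      raised-above r k<r = trans (cong₂ _+_ (cong₂ _+_ (δ-≢ (λ eq → <-irrefl (trans (sym star≡k) (cong lv eq)) k<r))
        (cong (m r ∸_) (δ-≢ (λ eq → <-irrefl (trans (sym p≡k) (cong lv eq)) k<r)))) (heap≡0 r (<⇒≤ k<r)))
        (+-identityʳ (m r))

      raised-M : ∀ l → M (heap k d) l ≡ 0 → M (raised m p) l ≡ M m l
      raised-M l none = trans (M-⊕ (δ (star i) ⊕ x) (heap k d) l) (trans (cong (M (δ (star i) ⊕ x) l +_) none)
        (trans (+-identityʳ _) (trans (M-⊕ (δ (star i)) x l)
          (trans (cong (_+ M x l) (M-δ (trans star≡k (sym p≡k)) l))
            (trans (sym (M-⊕ (δ p) x l)) (M-cong (δ-split m 0<mp) l))))))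

      raised-level : M (raised m p) k ≡ M m k
      raised-level = raised-M k (M-heap-apart 1+n≢n)

      raised-counts : potP L p ≡ maxPot L i → ∀ l → M (raised m p) l ≡ M m l
      raised-counts max l = raised-M l (cnt-none (λ q → lv q ≟ l) (λ q _ →
        trans (cong (λ e → heap k e q) (m≤n⇒m∸n≡0 (≤-reflexive (sym max)))) (heap-empty k q)))

      raised-stray : star i ≢ p → suc (cnt stray? (raised m p)) ≡ cnt stray? m
      raised-stray stray = trans (cong suc (trans (cnt-⊕ stray? (δ (star i) ⊕ x) (heap k d))
          (trans (cong₂ _+_ (cnt-⊕ stray? (δ (star i)) x) no-heap)
            (trans (+-identityʳ _) (cong (_+ cnt stray? x) (cnt-δ-out stray? (λ s → proj₂ s refl)))))))
        (trans (cong (_+ cnt stray? x) (sym (cnt-δ-in stray? (p≡i , stray))))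
          (trans (sym (cnt-⊕ stray? (δ p) x)) (cnt-cong stray? (λ r _ → δ-split m 0<mp r))))
        where
        no-heap : cnt stray? (heap k d) ≡ 0
        no-heap = cnt-none stray? (λ r s → heap≡0 r (≤-reflexive (cong toℕ (sym (proj₁ s)))))

    -- Each round raises one token that is not yet on `star i`, and the number of such tokens is the
    -- measure. Richness at level `i` itself makes every place of the level affordable, and it
    -- survives because raising only adds tokens below.
    gather : Rearrangeable k → ∀ m → Flat k m → Rich (suc k) m → ∃ (Gathered m)
    gather rearrange m = go (cnt stray? m) m ≤-refl
      where
      go : ∀ N m → cnt stray? m ≤ N → Flat k m → Rich (suc k) m → ∃ (Gathered m)
      go N m ≤N flat-m rich-m with any? (λ r → stray? r ×-dec (0 <? m r))
      ... | no none = m , record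
        { reach = ε ; flat = flat-m ; rich = rich-m
        ; above = λ _ _ → refl ; level = refl
        ; alone = λ r r≡i r≢ → ≯0⇒≡0 (λ 0<mr → none (r , (r≡i , r≢ ∘ sym) , 0<mr))
        ; counts = λ _ _ → refl }
      go zero m ≤N flat-m rich-m | yes (p , s , 0<mp) =
        contradiction (≤-trans 0<mp (≤-trans (term≤cnt stray? p s) ≤N)) λ ()
      go (suc N) m ≤N flat-m rich-m | yes (p , (p≡i , p≢) , 0<mp)
        with go N (raised m p) (≤-pred (≤-trans (≤-reflexive (raised-stray p≡i 0<mp p≢)) ≤N))
               (raised-flat p≡i 0<mp flat-m) (raised-rich p≡i 0<mp ≤-refl rich-m)
      ... | g , G = g , record
        { reach = raised-reach p≡i 0<mp rearrange flat-m (λ j j<k → rich-m j (≤-trans j<k (n≤1+n k)))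
                    (≤-trans (potP≤maxPot p) (≤-trans (≤-reflexive (cong (maxPot L) p≡i)) (rich-m i ≤-refl)))
                  ◅◅ reach G
        ; flat = flat G ; rich = rich G
        ; above = λ r k<r → trans (above G r k<r) (raised-above p≡i 0<mp r k<r)
        ; level = trans (level G) (raised-level p≡i 0<mp)
        ; alone = alone G
        ; counts = λ flat⁺ l → trans (counts G (raised-flat p≡i 0<mp flat⁺) l)
            (raised-counts p≡i 0<mp (trans (flat⁺ p (s≤s (≤-reflexive (cong toℕ p≡i))) 0<mp) (cong (maxPot L) p≡i)) l) }

    Gathered-flat : ∀ {m g} → Gathered m g → Flat (suc k) g
    Gathered-flat G r r<1+k 0<gr with lvP r ≟F i
    ... | no r≢i = flat G r (≤∧≢⇒< (≤-pred r<1+k) (r≢i ∘ toℕ-injective)) 0<gr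
    ... | yes r≡i with r ≟F star i
    ...   | yes refl = trans (star-max i) (cong (maxPot L) (sym r≡i))
    ...   | no r≢    = contradiction (subst (0 <_) (alone G r r≡i r≢) 0<gr) λ ()

    -- Level `i` is gathered in both markings. With all its tokens on one place, equal level sums
    -- become equal markings there, so the hypothesis for `k` links the two results; the second
    -- gathering is then undone.
    rearrangeable-suc : Rearrangeable k → Rearrangeable (suc k)
    rearrangeable-suc rearrange {m} {m′} flat-m flat-m′ rich-m agree same =
      reach G ◅◅ rearrange (flat G) (flat G′) (λ j j<k → rich G j (≤-trans j<k (n≤1+n k))) agree-g
        (λ l l<k → trans (counts G flat-m l) (trans (same l (≤-trans l<k (n≤1+n k))) (sym (counts G′ flat-m′ l))))
      ◅◅ Reach-sym (reach G′)
      where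
      weaken : ∀ {f} → Flat (suc k) f → Flat k f
      weaken flat-f r r<k = flat-f r (≤-trans r<k (n≤1+n k))
      -- Richness depends only on sums of levels below `k`, and these agree.
      rich-m′ : Rich (suc k) m′
      rich-m′ = Rich-≤ LM≡ rich-m
        where
        LM≡ : ∀ j → j < suc k → LM m j ≤ LM m′ j
        LM≡ zero    _   = ≤-reflexive (trans (LM-zero m) (sym (LM-zero m′)))
        LM≡ (suc l) l<k = ≤-reflexive (trans (LM-suc m l)
          (trans (same l (≤-trans (n≤1+n _) l<k)) (sym (LM-suc m′ l))))
      G-all = gather rearrange m (weaken flat-m) rich-m
      G′-all = gather rearrange m′ (weaken flat-m′) rich-m′
      G = proj₂ G-all
      G′ = proj₂ G′-all
      at-star : ∀ {f h} → Gathered f h → M h k ≡ h (star i)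
      at-star H = cnt-only (λ q → lv q ≟ k) (star i) (cong toℕ (star-level i))
        (λ q q≡k → alone H q (toℕ-injective q≡k))
      agree-g : ∀ r → k ≤ lv r → proj₁ G-all r ≡ proj₁ G′-all r
      agree-g r k≤r with lvP r ≟F i
      ... | no r≢i = trans (above G r k<r) (trans (agree r k<r) (sym (above G′ r k<r)))
        where k<r = ≤∧≢⇒< k≤r (λ eq → r≢i (toℕ-injective (sym eq)))
      ... | yes r≡i with r ≟F star i
      ...   | yes refl = trans (sym (at-star G)) (trans (level G) (trans (same k ≤-refl)
                           (trans (sym (level G′)) (at-star G′))))
      ...   | no r≢    = trans (alone G r r≡i r≢) (sym (alone G′ r r≡i r≢))

  rearrangeable : ∀ k → k ≤ n → Rearrangeable k
  rearrangeable zero    _   _ _ _ agree _ = ⇝-refl (λ r → agree r z≤n)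
  rearrangeable (suc k) k<n = subst (Rearrangeable ∘ suc) (toℕ-fromℕ< k<n)
    (rearrangeable-suc (fromℕ< k<n) (subst Rearrangeable (sym (toℕ-fromℕ< k<n)) (rearrangeable k (<⇒≤ k<n))))

  -- Settling all levels from the bottom upwards.

  Supplied : Fin n → (Fin np → ℕ) → Set
  Supplied i m = maxPot L i ≤ LM m (toℕ i) ⊎ ∃ λ p → lvP p ≡ i × 0 < m p × potP L p ≤ LM m (toℕ i)

  -- `above` and `level` preserve the supply of level `k`: its tokens and the number of tokens just
  -- below are those of `m`, although deeper levels may have gained tokens.
  record Settled (k : ℕ) (m c : Fin np → ℕ) : Set where
    field
      reach : m ⇝ c
      flat  : Flat k c
      rich  : Rich k c
      above : ∀ r → k ≤ lv r → c r ≡ m r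
      level : LM c k ≡ LM m k

  -- A single affordable token suffices: raising it adds `maxPot L i ∸ potP L p` tokens to a level
  -- that held at least `potP L p`.
  enrich : ∀ i {c} → Flat (toℕ i) c → Rich (toℕ i) c → Supplied i c →
    ∃ λ c′ → c ⇝ c′ × Flat (toℕ i) c′ × Rich (suc (toℕ i)) c′ ×
      (∀ r → toℕ i < lv r → c′ r ≡ c r) × M c′ (toℕ i) ≡ M c (toℕ i)
  enrich i {c} flat rich (inj₁ enough) = c , ε , flat , rich⁺ , (λ _ _ → refl) , refl
    where
    rich⁺ : Rich (suc (toℕ i)) c
    rich⁺ j j≤i with j ≟F i
    ... | yes refl = enough
    ... | no j≢i   = rich j (≤∧≢⇒< (≤-pred j≤i) (j≢i ∘ toℕ-injective))
  enrich i {c} flat rich (inj₂ (p , p≡i , 0<cp , enough)) =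
    raised i c p , raised-reach i p≡i 0<cp (rearrangeable k (<⇒≤ (toℕ<n i))) flat rich enough ,
    raised-flat i p≡i 0<cp flat , rich⁺ , raised-above i p≡i 0<cp , raised-level i p≡i 0<cp
    where
    k = toℕ i
    d = maxPot L i ∸ potP L p
    -- On the bottom level there is nowhere to put released tokens, but all potentials are 0 and
    -- none are released.
    bottom : k ≡ 0 → d ≡ 0
    bottom k≡0 = trans (cong (_∸ potP L p) (trans (sym (star-max i))
      (potP-bottom (trans (cong toℕ (star-level i)) k≡0)))) (0∸n≡0 (potP L p))
    rich⁺ : Rich (suc k) (raised i c p)
    rich⁺ j j≤i with j ≟F i
    ... | no j≢i   = raised-rich i p≡i 0<cp (n≤1+n k) rich j (≤∧≢⇒< (≤-pred j≤i) (j≢i ∘ toℕ-injective))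
    ... | yes refl = begin
      maxPot L i                   ≤⟨ m≤n+m∸n (maxPot L i) (potP L p) ⟩
      potP L p + d                 ≤⟨ +-monoˡ-≤ d enough ⟩
      LM c k + d                   ≡⟨ cong (LM c k +_) (LM-heap (<⇒≤ (toℕ<n i)) bottom) ⟨
      LM c k + LM (heap k d) k     ≡⟨ raised-LM i p≡i 0<cp k ≤-refl ⟩
      LM (raised i c p) k          ∎
      where open ≤-Reasoning

  settle-suc : ∀ i {m c} → Supplied i m → Settled (toℕ i) m c → ∃ (Settled (suc (toℕ i)) m)
  settle-suc i {m} {c} supplied S with enrich i (flat S) (rich S) (transfer supplied)
    where
    open Settled
    transfer : Supplied i m → Supplied i c
    transfer (inj₁ enough) = inj₁ (≤-trans enough (≤-reflexive (sym (level S))))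
    transfer (inj₂ (p , p≡i , 0<mp , enough)) = inj₂ (p , p≡i ,
      subst (0 <_) (sym (above S p (≤-reflexive (cong toℕ (sym p≡i))))) 0<mp ,
      ≤-trans enough (≤-reflexive (sym (level S))))
  ... | c′ , c⇝c′ , flat′ , rich′ , above′ , level′
    with gather i (rearrangeable (toℕ i) (<⇒≤ (toℕ<n i))) c′ flat′ rich′
  ... | g , G = g , record
    { reach = reach S ◅◅ c⇝c′ ◅◅ Gathered.reach G
    ; flat = Gathered-flat i G
    ; rich = Gathered.rich G
    ; above = λ r i<r → trans (Gathered.above G r i<r) (trans (above′ r i<r) (above S r (<⇒≤ i<r)))
    ; level = trans (LM-suc g (toℕ i)) (trans (Gathered.level G) (trans level′
        (trans (cnt-cong (λ q → lv q ≟ toℕ i) (λ q q≡i → above S q (≤-reflexive (sym q≡i)))) (sym (LM-suc m (toℕ i)))))) }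
    where open Settled

  settle : ∀ k → k ≤ n → ∀ m → (∀ i → Supplied i m) → ∃ (Settled k m)
  settle zero    _   m supplied = m , record
    { reach = ε ; flat = λ _ () ; rich = λ _ () ; above = λ _ _ → refl ; level = refl }
  settle (suc k) k<n m supplied = subst (λ j → ∃ (Settled (suc j) m)) i≡k
    (settle-suc i (supplied i) (proj₂ below))
    where
    i : Fin n
    i = fromℕ< k<n
    i≡k : toℕ i ≡ k
    i≡k = toℕ-fromℕ< k<n
    below : ∃ (Settled (toℕ i) m)
    below = subst (λ j → ∃ (Settled j m)) (sym i≡k) (settle k (<⇒≤ k<n) m supplied)

-- Witness sums: invariance and relation to level sums.

sumZ-cong : ∀ k {f g : Fin k → ℤ} → f ≗ g → sumZ k f ≡ sumZ k g
sumZ-cong zero    f≗g = refl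
sumZ-cong (suc k) f≗g = cong₂ ℤ._+_ (f≗g fz) (sumZ-cong k (f≗g ∘ fs))

sumZ-zero : ∀ k {f : Fin k → ℤ} → (∀ p → f p ≡ ℤ.0ℤ) → sumZ k f ≡ ℤ.0ℤ
sumZ-zero zero    f≡0 = refl
sumZ-zero (suc k) f≡0 = cong₂ ℤ._+_ (f≡0 fz) (sumZ-zero k (f≡0 ∘ fs))

+-interchange : ∀ a b c d → (a ℤ.+ b) ℤ.+ (c ℤ.+ d) ≡ (a ℤ.+ c) ℤ.+ (b ℤ.+ d)
+-interchange = solve-∀

sumZ-+ : ∀ k (f g : Fin k → ℤ) → sumZ k (λ i → f i ℤ.+ g i) ≡ sumZ k f ℤ.+ sumZ k g
sumZ-+ zero    f g = refl
sumZ-+ (suc k) f g = trans (cong (ℤ._+_ (f fz ℤ.+ g fz)) (sumZ-+ k (f ∘ fs) (g ∘ fs)))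
  (+-interchange (f fz) (g fz) (sumZ k (f ∘ fs)) (sumZ k (g ∘ fs)))

sumZ-neg : ∀ k (f : Fin k → ℤ) → sumZ k (λ i → ℤ.- f i) ≡ ℤ.- sumZ k f
sumZ-neg zero    f = refl
sumZ-neg (suc k) f = trans (cong (ℤ._+_ (ℤ.- f fz)) (sumZ-neg k (f ∘ fs)))
  (sym (ℤ.neg-distrib-+ (f fz) (sumZ k (f ∘ fs))))

sumZ-pos : ∀ k (f : Fin k → ℕ) → sumZ k (λ i → ℤ.+ f i) ≡ ℤ.+ sumF k f
sumZ-pos zero    f = refl
sumZ-pos (suc k) f = cong (ℤ._+_ (ℤ.+ f fz)) (sumZ-pos k (f ∘ fs))

-- The shape of the alternating sum in the witness of a complex `C s`: by `weight-C` each weight is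
-- a sum of two consecutive chain sums.
telescope : ∀ N (a : ℕ → ℤ) →
  sumZ N (λ j → negPow (suc (toℕ j)) ℤ.* (a (toℕ j) ℤ.+ a (suc (toℕ j)))) ≡ ℤ.- a 0 ℤ.+ negPow N ℤ.* a N
telescope zero    a = base (a 0)
  where
  base : ∀ x → ℤ.0ℤ ≡ ℤ.- x ℤ.+ ℤ.1ℤ ℤ.* x
  base x = sym (trans (cong (ℤ._+_ (ℤ.- x)) (ℤ.*-identityˡ x)) (ℤ.+-inverseˡ x))
telescope (suc N) a = trans
  (cong₂ ℤ._+_ (ℤ.-1*i≡-i (a 0 ℤ.+ a 1))
    (trans (sumZ-cong N (λ j → sym (ℤ.neg-distribˡ-* (negPow (suc (toℕ j))) _)))
      (trans (sumZ-neg N _) (cong ℤ.-_ (telescope N (a ∘ suc))))))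
  (collect (a 0) (a 1) (negPow N) (a (suc N)))
  where
  collect : ∀ a₀ a₁ s b → ℤ.- (a₀ ℤ.+ a₁) ℤ.+ ℤ.- (ℤ.- a₁ ℤ.+ s ℤ.* b) ≡ ℤ.- a₀ ℤ.+ (ℤ.- s) ℤ.* b
  collect = solve-∀

module Invariant (L : LNet) (Π³ : IsΠ3Net L) where
  open LNet L
  open Net L Π³
  open Move L Π³
  open import Data.Integer using (+_)

  -- Every nonzero factor `pot` descends exactly one level. This rules out chains that would have to
  -- start above the top level.
  chain-level : ∀ j {r p} → 0 < chainW L j r p → lv r ≡ suc j + lv p
  chain-level zero    0<pot = sym (pot-below 0<pot)
  chain-level (suc j) {r} {p} 0<sum
    with any? (λ q → 0 <? pot L r q * chainW L j q p)
  ... | no none = contradiction 0<sum (≤⇒≯ (≤-reflexive (sumF-zero np (λ q → ≯0⇒≡0 (λ 0<q → none (q , 0<q))))))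
  ... | yes (q , 0<q) = trans (sym (pot-below (factorˡ _ 0<q))) (cong suc (chain-level j (factorʳ (pot L r q) 0<q)))
    where
    factorˡ : ∀ a {b} → 0 < a * b → 0 < a
    factorˡ (suc a) _ = z<s
    factorʳ : ∀ a {b} → 0 < a * b → 0 < b
    factorʳ a {zero}  0<ab = subst (0 <_) (*-zeroʳ a) 0<ab
    factorʳ a {suc b} _    = z<s

  weight : (Fin np → ℕ) → ℕ → Fin np → ℤ
  weight f j p = sumZ np (λ r → + f r ℤ.* + chainW L j r p)

  weight-⊕ : ∀ f g j p → weight (f ⊕ g) j p ≡ weight f j p ℤ.+ weight g j p
  weight-⊕ f g j p = trans
    (sumZ-cong np (λ r → ℤ.*-distribʳ-+ (+ chainW L j r p) (+ f r) (+ g r)))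
    (sumZ-+ np _ _)

  wit : (Fin np → ℕ) → Fin np → ℤ
  wit f = witness L (λ r → + f r)

  wit-⊕ : ∀ f g p → wit (f ⊕ g) p ≡ wit f p ℤ.+ wit g p
  wit-⊕ f g p = trans (cong (ℤ._+_ (+ (f p + g p))) (trans
      (sumZ-cong N (λ j → trans (cong (ℤ._*_ (sign j)) (weight-⊕ f g (toℕ j) p))
        (ℤ.*-distribˡ-+ (sign j) (weight f (toℕ j) p) (weight g (toℕ j) p))))
      (sumZ-+ N _ _)))
    (+-interchange (+ f p) (+ g p) (sumZ N (λ j → sign j ℤ.* weight f (toℕ j) p))
      (sumZ N (λ j → sign j ℤ.* weight g (toℕ j) p)))
    where
    N = n ∸ suc (lv p)
    sign : Fin N → ℤ
    sign j = negPow (suc (toℕ j))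

  -- The token on `s` contributes the chains starting at `s`; the tokens of `pot L s` contribute
  -- those chains prolonged by one factor.
  weight-C : ∀ s j p → weight (C s) j p ≡ + chainW L j s p ℤ.+ + chainW L (suc j) s p
  weight-C s j p = trans (sumZ-cong np (λ r → sym (ℤ.pos-* (C s r) (chainW L j r p))))
    (trans (sumZ-pos np (λ r → C s r * chainW L j r p)) (cong +_ sum≡))
    where
    sum≡ : sumF np (λ r → C s r * chainW L j r p) ≡ chainW L j s p + chainW L (suc j) s p
    sum≡ = trans (sumF-cong np (λ r → *-distribʳ-+ (chainW L j r p) (δ s r) (pot L s r)))
      (trans (sumF-⊕ np _ _) (cong (_+ chainW L (suc j) s p)
        (trans (sumF-only np s (λ r r≢s → cong (_* chainW L j r p) (δ-≢ (r≢s ∘ sym))))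
          (trans (cong (_* chainW L j s p) (δ-refl s)) (*-identityˡ _)))))

  -- The witness is the coordinate map of the basis C.
  wit-C : ∀ s p → wit (C s) p ≡ + δ s p
  wit-C s p = trans (cong (ℤ._+_ (+ C s p)) (trans
      (sumZ-cong N (λ j → cong (ℤ._*_ (negPow (suc (toℕ j)))) (weight-C s (toℕ j) p)))
      (trans (telescope N (λ j → + chainW L j s p))
        (cong (λ c → ℤ.- (+ pot L s p) ℤ.+ negPow N ℤ.* + c) too-long))))
    (cancel (+ δ s p) (+ pot L s p) (negPow N))
    where
    N = n ∸ suc (lv p)
    -- A chain of `N`+1 factors ending at `p` would start at level index `n`, one past the top;
    -- hence the last term of the telescope vanishes.
    too-long : chainW L N s p ≡ 0
    too-long = ≯0⇒≡0 (λ 0<c → <-irrefl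
      (trans (chain-level N 0<c) (trans (sym (+-suc N (lv p))) (m∸n+n≡m (toℕ<n (lvP p))))) (toℕ<n (lvP s)))
    cancel : ∀ a b s → (a ℤ.+ b) ℤ.+ (ℤ.- b ℤ.+ s ℤ.* ℤ.0ℤ) ≡ a
    cancel = solve-∀

  -- Levels are natural numbers here so that `F (suc l)` also makes sense at the top level, where it
  -- is 0.
  F : ℕ → (Fin np → ℕ) → ℤ
  F l f = sumZ np (λ p → if ⌊ lv p ≟ l ⌋ then wit f p else + 0)

  F-cong : ∀ l {f g} → f ≗ g → F l f ≡ F l g
  F-cong l {f} {g} f≗g = sumZ-cong np (λ p → cong (λ v → if ⌊ lv p ≟ l ⌋ then v else + 0) (wit≡ p))
    where
    wit≡ : ∀ p → wit f p ≡ wit g p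
    wit≡ p = cong₂ ℤ._+_ (cong +_ (f≗g p)) (sumZ-cong (n ∸ suc (lv p)) (λ j →
      cong (ℤ._*_ (negPow (suc (toℕ j)))) (sumZ-cong np (λ r → cong (λ v → + v ℤ.* + chainW L (toℕ j) r p) (f≗g r)))))

  F-⊕ : ∀ l f g → F l (f ⊕ g) ≡ F l f ℤ.+ F l g
  F-⊕ l f g = trans (sumZ-cong np pointwise) (sumZ-+ np _ _)
    where
    pointwise : ∀ p → (if ⌊ lv p ≟ l ⌋ then wit (f ⊕ g) p else + 0)
      ≡ (if ⌊ lv p ≟ l ⌋ then wit f p else + 0) ℤ.+ (if ⌊ lv p ≟ l ⌋ then wit g p else + 0)
    pointwise p with ⌊ lv p ≟ l ⌋
    ... | true  = wit-⊕ f g p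
    ... | false = refl

  F-C : ∀ l s → F l (C s) ≡ + M (δ s) l
  F-C l s = trans (sumZ-cong np pointwise) (sumZ-pos np _)
    where
    pointwise : ∀ p → (if ⌊ lv p ≟ l ⌋ then wit (C s) p else + 0) ≡ + (if ⌊ lv p ≟ l ⌋ then δ s p else 0)
    pointwise p with ⌊ lv p ≟ l ⌋
    ... | true  = wit-C s p
    ... | false = refl

  -- A step replaces `C p` by `C q` on the same level, and by `F-C` both contribute the same amount
  -- to each witness sum.
  F-step : ∀ l {m m′} → Step L m m′ → F l (lookup m) ≡ F l (lookup m′)
  F-step l {m} {m′} step with step-shape {m} {m′} step
  ... | p , q , x , _ , same , before , after = begin
    F l (lookup m)               ≡⟨ F-cong l before ⟩
    F l (C p ⊕ x)                ≡⟨ F-⊕ l (C p) x ⟩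
    F l (C p) ℤ.+ F l x          ≡⟨ cong (ℤ._+ F l x) (trans (F-C l p) (trans (cong +_ (M-δ (cong toℕ same) l)) (sym (F-C l q)))) ⟩
    F l (C q) ℤ.+ F l x          ≡⟨ F-⊕ l (C q) x ⟨
    F l (C q ⊕ x)                ≡⟨ F-cong l after ⟨
    F l (lookup m′)              ∎
    where open ≡-Reasoning

  F-reach : ∀ l {m m′} → Reach L m m′ → F l (lookup m) ≡ F l (lookup m′)
  F-reach l ε = refl
  F-reach l (_◅_ {m} {m′} step path) = trans (F-step l {m} {m′} step) (F-reach l path)

  F-⇝ : ∀ l {f g} → f ⇝ g → F l f ≡ F l g
  F-⇝ l {f} {g} path = trans (sym (F-cong l (lookup∘tabulate f)))
    (trans (F-reach l path) (F-cong l (lookup∘tabulate g)))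

  F-out : ∀ {l} → n ≤ l → ∀ f → F l f ≡ + 0
  F-out {l} n≤l f = sumZ-zero np pointwise
    where
    pointwise : ∀ p → (if ⌊ lv p ≟ l ⌋ then wit f p else + 0) ≡ + 0
    pointwise p = if-no (lv p ≟ l) (λ { refl → <-irrefl refl (≤-trans (toℕ<n (lvP p)) n≤l) })

  witnessOf≡F : ∀ m i → witnessOf L (toZ L m) i ≡ F (toℕ i) (lookup m)
  witnessOf≡F m i = sumZ-cong np pointwise
    where
    pointwise : ∀ p → (if ⌊ lvP p ≟F i ⌋ then witness L (toZ L m) p else + 0)
                    ≡ (if ⌊ lv p ≟ toℕ i ⌋ then wit (lookup m) p else + 0)
    pointwise p with lvP p ≟F i
    ... | yes p≡i = sym (if-yes (lv p ≟ toℕ i) (cong toℕ p≡i))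
    ... | no p≢i  = sym (if-no (lv p ≟ toℕ i) (p≢i ∘ toℕ-injective))

  -- 0 above the top level.
  maxPotAt : ℕ → ℕ
  maxPotAt l with l <? n
  ... | yes l<n = maxPot L (fromℕ< l<n)
  ... | no _    = 0

  maxPotAt-level : ∀ p → maxPotAt (lv p) ≡ maxPot L (lvP p)
  maxPotAt-level p with lv p <? n
  ... | yes lt = cong (maxPot L) (toℕ-injective (toℕ-fromℕ< lt))
  ... | no ≮n  = contradiction (toℕ<n (lvP p)) ≮n

  -- Vanishes on flat markings: it vanishes on C p for flat p, and pot p is flat of lower level.
  -- Hence level sums of flat markings are functions of their witness sums.
  defect : ℕ → (Fin np → ℕ) → ℤ
  defect l m = + M m l ℤ.- (F l m ℤ.+ + maxPotAt (suc l) ℤ.* F (suc l) m)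

  defect-cong : ∀ l {f g} → f ≗ g → defect l f ≡ defect l g
  defect-cong l f≗g = cong₂ ℤ._-_ (cong +_ (M-cong f≗g l))
    (cong₂ (λ a b → a ℤ.+ + maxPotAt (suc l) ℤ.* b) (F-cong l f≗g) (F-cong (suc l) f≗g))

  defect-⊕ : ∀ l f g → defect l (f ⊕ g) ≡ defect l f ℤ.+ defect l g
  defect-⊕ l f g = trans (cong₂ ℤ._-_ (cong +_ (M-⊕ f g l))
      (cong₂ (λ a b → a ℤ.+ + maxPotAt (suc l) ℤ.* b) (F-⊕ l f g) (F-⊕ (suc l) f g)))
    (rearr (+ M f l) (+ M g l) (F l f) (F l g) (+ maxPotAt (suc l)) (F (suc l) f) (F (suc l) g))
    where
    rearr : ∀ a b c d k e h → (a ℤ.+ b) ℤ.- ((c ℤ.+ d) ℤ.+ k ℤ.* (e ℤ.+ h))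
          ≡ (a ℤ.- (c ℤ.+ k ℤ.* e)) ℤ.+ (b ℤ.- (d ℤ.+ k ℤ.* h))
    rearr = solve-∀

  -- Additivity forces this, as the empty marking is its own double.
  defect-zero : ∀ l → defect l (λ _ → 0) ≡ + 0
  defect-zero l = identityʳ-unique _ _ (sym (defect-⊕ l (λ _ → 0) (λ _ → 0)))

  M-pot-flat : ∀ {p} l → potP L p ≡ maxPot L (lvP p) → M (pot L p) l ≡ maxPotAt (suc l) * M (δ p) (suc l)
  M-pot-flat {p} l flat = cases (lv p ≟ suc l)
    where
    cases : Dec (lv p ≡ suc l) → M (pot L p) l ≡ maxPotAt (suc l) * M (δ p) (suc l)
    cases (yes eq) = trans (M-pot (sym eq)) (trans flat (trans (sym (maxPotAt-level p)) (trans (cong maxPotAt eq)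
      (sym (trans (cong (λ v → maxPotAt (suc l) * v) (cnt-δ-in (λ q → lv q ≟ suc l) eq)) (*-identityʳ _))))))
    cases (no apart) = trans (M-pot-apart (apart ∘ sym))
      (sym (trans (cong (λ v → maxPotAt (suc l) * v) (cnt-δ-out (λ q → lv q ≟ suc l) apart)) (*-zeroʳ (maxPotAt (suc l)))))

  defect-C : ∀ l {p} → potP L p ≡ maxPot L (lvP p) → defect l (C p) ≡ + 0
  defect-C l {p} flat = trans (cong₂ ℤ._-_
      (trans (cong +_ (trans (M-⊕ (δ p) (pot L p) l) (cong (λ v → M (δ p) l + v) (M-pot-flat l flat))))
        (cong (ℤ._+_ (+ M (δ p) l)) (ℤ.pos-* (maxPotAt (suc l)) (M (δ p) (suc l)))))
      (cong₂ (λ a b → a ℤ.+ + maxPotAt (suc l) ℤ.* b) (F-C l p) (F-C (suc l) p)))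
    (ℤ.+-inverseʳ (+ M (δ p) l ℤ.+ + maxPotAt (suc l) ℤ.* + M (δ p) (suc l)))

  -- `k` bounds the level of `p` and drives the recursion: `C p` is `δ p` plus tokens on flat places
  -- strictly below, which `marking-induction` treats one by one.
  defect-δ : ∀ l k {p} → lv p < k → potP L p ≡ maxPot L (lvP p) → defect l (δ p) ≡ + 0
  defect-δ l (suc k) {p} p<k flat = trans (sym (ℤ.+-identityʳ _))
    (trans (cong (ℤ._+_ (defect l (δ p))) (sym defect-pot))
      (trans (sym (defect-⊕ l (δ p) (pot L p))) (defect-C l flat)))
    where
    defect-pot : defect l (pot L p) ≡ + 0
    defect-pot = marking-induction (λ m → defect l m ≡ + 0)
      (λ f≗g f≡0 → trans (sym (defect-cong l f≗g)) f≡0) (defect-zero l)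
      (λ {f} {g} f≡0 g≡0 → trans (defect-⊕ l f g) (cong₂ ℤ._+_ f≡0 g≡0))
      (pot L p) (λ r 0<pot → defect-δ l k (≤-trans (≤-reflexive (pot-below 0<pot)) (≤-pred p<k)) (pot-flat 0<pot))

  defect-flat : ∀ l {m} → Flat n m → defect l m ≡ + 0
  defect-flat l {m} flat = marking-induction (λ m → defect l m ≡ + 0)
    (λ f≗g f≡0 → trans (sym (defect-cong l f≗g)) f≡0) (defect-zero l)
    (λ {f} {g} f≡0 g≡0 → trans (defect-⊕ l f g) (cong₂ ℤ._+_ f≡0 g≡0))
    m (λ r 0<mr → defect-δ l n (toℕ<n (lvP r)) (flat r (toℕ<n (lvP r)) 0<mr))

  flat-counts : ∀ {c c′} → Flat n c → Flat n c′ → (∀ l → F l c ≡ F l c′) → ∀ l → M c l ≡ M c′ l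
  flat-counts {c} {c′} flat flat′ F≡ l = ℤ.+-injective (begin
    + M c l                                            ≡⟨ ℤ.i-j≡0⇒i≡j _ _ (defect-flat l flat) ⟩
    F l c ℤ.+ + maxPotAt (suc l) ℤ.* F (suc l) c       ≡⟨ cong₂ (λ a b → a ℤ.+ + maxPotAt (suc l) ℤ.* b) (F≡ l) (F≡ (suc l)) ⟩
    F l c′ ℤ.+ + maxPotAt (suc l) ℤ.* F (suc l) c′     ≡⟨ ℤ.i-j≡0⇒i≡j _ _ (defect-flat l flat′) ⟨
    + M c′ l                                           ∎)
    where open ≡-Reasoning

-- Liveness, the n-condition and reachability.

∧-true : ∀ {a b} → a ∧ b ≡ true → a ≡ true × b ≡ true
∧-true {true} {true} _ = refl , refl

module Reachability (L : LNet) (Π³ : IsΠ3Net L) where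
  open LNet L
  open IsOrderedΠNet (proj₁ Π³)
  open Net L Π³
  open Move L Π³
  open Invariant L Π³

  markOf≡M : ∀ m i → markOf L m i ≡ M (lookup m) (toℕ i)
  markOf≡M m i = cnt-resp (λ p → lvP p ≟F i) (λ p → lv p ≟ toℕ i) (λ _ → cong toℕ) (λ _ → toℕ-injective)

  markOf≡LM : ∀ m {q j : Fin n} → suc (toℕ q) ≡ toℕ j → markOf L m q ≡ LM (lookup m) (toℕ j)
  markOf≡LM m {q} below = trans (markOf≡M m q)
    (trans (sym (LM-suc (lookup m) (toℕ q))) (cong (LM (lookup m)) below))

  φ-Spec : Fin n → Marking L → Set
  φ-Spec j m =
    (φ L j m ≡ maxPot L j × ∀ p → lvP p ≡ j → ¬ 0 < lookup m p) ⊎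
    ((∃ λ p → lvP p ≡ j × 0 < lookup m p × potP L p ≡ φ L j m) ×
     ∀ p → lvP p ≡ j → 0 < lookup m p → φ L j m ≤ potP L p)

  φ-spec : ∀ j m → φ-Spec j m
  φ-spec j m with minSel np (λ p → ⌊ lvP p ≟F j ⌋ ∧ ⌊ 1 ≤? lookup m p ⌋) (potP L) in eq
  ... | nothing = inj₁ (refl , λ p p≡j 0<mp → contradiction (trans
          (sym (minSel-nothing np (λ p → ⌊ lvP p ≟F j ⌋ ∧ ⌊ 1 ≤? lookup m p ⌋) (potP L) eq p))
          (cong₂ _∧_ (⌊⌋-true (lvP p ≟F j) p≡j) (⌊⌋-true (1 ≤? lookup m p) 0<mp))) λ ())
  ... | just v with minSel-just np (λ p → ⌊ lvP p ≟F j ⌋ ∧ ⌊ 1 ≤? lookup m p ⌋) (potP L) eq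
  ...   | (p , sp , pot≡v) , least with ∧-true {⌊ lvP p ≟F j ⌋} sp
  ...     | p≡j , 0<mp = inj₂ ((p , true-⌊⌋ (lvP p ≟F j) p≡j , true-⌊⌋ (1 ≤? lookup m p) 0<mp , pot≡v) ,
            λ q q≡j 0<mq → least q (cong₂ _∧_ (⌊⌋-true (lvP q ≟F j) q≡j) (⌊⌋-true (1 ≤? lookup m q) 0<mq)))

  -- The first alternative covers the bottom level, where potentials are 0, and empty levels, where
  -- `φ` is the maximal potential. Otherwise the marked place attaining the minimum `φ` is
  -- affordable.
  supplied : ∀ m → NCondition L m → ∀ j → Supplied j (lookup m)
  supplied m (_ , φ≤) j = cases (toℕ j) refl
    where
    cases : ∀ k → toℕ j ≡ k → Supplied j (lookup m)
    cases zero j≡0 = inj₁ (≤-trans (≤-reflexive (trans (sym (star-max j))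
      (potP-bottom (trans (cong toℕ (star-level j)) j≡0)))) z≤n)
    cases (suc l) j≡1+l = from-φ (φ-spec j m)
      where
      l<n : l < n
      l<n = ≤-trans (≤-reflexive (sym j≡1+l)) (<⇒≤ (toℕ<n j))
      below : suc (toℕ (fromℕ< l<n)) ≡ toℕ j
      below = trans (cong suc (toℕ-fromℕ< l<n)) (sym j≡1+l)
      φ≤LM : φ L j m ≤ LM (lookup m) (toℕ j)
      φ≤LM = ≤-trans (φ≤ j (fromℕ< l<n) below) (≤-reflexive (markOf≡LM m below))
      from-φ : φ-Spec j m → Supplied j (lookup m)
      from-φ (inj₁ (φ≡ , _)) = inj₁ (subst (_≤ LM (lookup m) (toℕ j)) φ≡ φ≤LM)
      from-φ (inj₂ ((p , p≡j , 0<mp , pot≡φ) , _)) =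
        inj₂ (p , p≡j , 0<mp , subst (_≤ LM (lookup m) (toℕ j)) (sym pot≡φ) φ≤LM)

  -- The negation of the n-condition at level j; it persists and disables all transitions of level j.
  Starved : Fin n → (Fin np → ℕ) → Set
  Starved j m = LM m (toℕ j) < maxPot L j × ∀ p → lvP p ≡ j → 0 < m p → LM m (toℕ j) < potP L p

  φ-starved : ∀ {j q} m → suc (toℕ q) ≡ toℕ j → markOf L m q < φ L j m → Starved j (lookup m)
  φ-starved {j} {q} m below <φ with φ-spec j m
  ... | inj₁ (φ≡ , none) = ≤-trans LM<φ (≤-reflexive φ≡) , λ p p≡j 0<mp → contradiction 0<mp (none p p≡j)
    where LM<φ = subst (_< φ L j m) (markOf≡LM m below) <φ
  ... | inj₂ ((p , p≡j , _ , pot≡φ) , least) =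
    ≤-trans LM<φ (≤-trans (≤-reflexive (sym pot≡φ)) (subst (λ i → potP L p ≤ maxPot L i) p≡j (potP≤maxPot p))) ,
    λ r r≡j 0<mr → ≤-trans LM<φ (least r r≡j 0<mr)
    where LM<φ = subst (_< φ L j m) (markOf≡LM m below) <φ

  -- Containing `C p` means marking `p` and having at least `potP L p` tokens one level below, which
  -- starvation forbids on level `j`.
  starved-excludes : ∀ {j m p x} → Starved j m → m ≗ C p ⊕ x → lvP p ≢ j
  starved-excludes {j} {m} {p} {x} (_ , starved) m≗ p≡j = <-irrefl refl (≤-trans (starved p p≡j 0<mp) pot≤LM)
    where
    0<mp : 0 < m p
    0<mp = ≤-trans (≤-reflexive (sym (δ-refl p))) (≤-trans (m≤m+n _ _) (≤-trans (m≤m+n _ (x p)) (≤-reflexive (sym (m≗ p)))))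
    pot≤LM : potP L p ≤ LM m (toℕ j)
    pot≤LM = ≤-trans (≤-reflexive (sym (LM-pot (cong toℕ p≡j)))) (≤-trans (LM-⊕-≤ʳ (δ p) (pot L p) (toℕ j))
      (≤-trans (LM-⊕-≤ˡ (C p) x (toℕ j)) (≤-reflexive (sym (LM-cong m≗ (toℕ j))))))

  M-exchange : ∀ l {p q} x → lvP p ≡ lvP q → suc l ≢ lv p → M (C p ⊕ x) l ≡ M (C q ⊕ x) l
  M-exchange l {p} {q} x same apart = trans (expand p apart) (trans
    (cong (λ v → v + 0 + M x l) (M-δ (cong toℕ same) l))
    (sym (expand q (λ eq → apart (trans eq (cong toℕ (sym same)))))))
    where
    expand : ∀ p → suc l ≢ lv p → M (C p ⊕ x) l ≡ M (δ p) l + 0 + M x l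
    expand p apart = trans (M-⊕ (C p) x l) (cong (_+ M x l)
      (trans (M-⊕ (δ p) (pot L p) l) (cong (M (δ p) l +_) (M-pot-apart apart))))

  LM-exchange : ∀ k {p q} x → lvP p ≡ lvP q → k ≢ lv p → LM (C p ⊕ x) k ≡ LM (C q ⊕ x) k
  LM-exchange zero    {p} {q} x _ _ = trans (LM-zero (C p ⊕ x)) (sym (LM-zero (C q ⊕ x)))
  LM-exchange (suc l) {p} {q} x same apart =
    trans (LM-suc (C p ⊕ x) l) (trans (M-exchange l x same apart) (sym (LM-suc (C q ⊕ x) l)))

  -- Only transitions of level `j` change the count one level below, and these are excluded.
  starved-step : ∀ {j m m′} → Step L m m′ → Starved j (lookup m) → Starved j (lookup m′)
  starved-step {j} {m} {m′} step starved@(few , marked) with step-shape {m} {m′} step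
  ... | p , q , x , _ , same , before , after =
    subst (_< maxPot L j) LM≡ few , λ r r≡j 0<m′r → subst (_< potP L r) LM≡ (marked′ r r≡j 0<m′r)
    where
    p≢j : lvP p ≢ j
    p≢j = starved-excludes starved before
    LM≡ : LM (lookup m) (toℕ j) ≡ LM (lookup m′) (toℕ j)
    LM≡ = trans (LM-cong before (toℕ j)) (trans
      (LM-exchange (toℕ j) x same (λ eq → p≢j (toℕ-injective (sym eq)))) (sym (LM-cong after (toℕ j))))
    marked′ : ∀ r → lvP r ≡ j → 0 < lookup m′ r → LM (lookup m) (toℕ j) < potP L r
    marked′ r r≡j 0<m′r with 0<+⇒ (C q r) (subst (0 <_) (after r) 0<m′r)
    ... | inj₂ 0<x = marked r r≡j (≤-trans 0<x (≤-trans (m≤n+m (x r) (C p r)) (≤-reflexive (sym (before r)))))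
    ... | inj₁ 0<C with 0<+⇒ (δ q r) 0<C
    ...   | inj₁ 0<δ   = contradiction (subst (0 <_) (δ-≢ (λ eq → p≢j (trans same (trans (cong lvP eq) r≡j)))) 0<δ) λ ()
    -- A token newly put on level `j` by a transition of the next level lies on a place of maximal
    -- potential, still beyond the supply by `few`.
    ...   | inj₂ 0<pot = ≤-trans few (≤-reflexive (sym (trans (pot-flat 0<pot) (cong (maxPot L) r≡j))))

  starved-reach : ∀ {j m m′} → Reach L m m′ → Starved j (lookup m) → Starved j (lookup m′)
  starved-reach ε starved = starved
  starved-reach (_◅_ {m} {m′} step path) starved = starved-reach path (starved-step {m = m} {m′} step starved)

  -- The count of a level changes only by transitions one level higher, and the top level has none
  -- above it.
  M-top-reach : ∀ {top : Fin n} {m m′} → suc (toℕ top) ≡ n → Reach L m m′ → M (lookup m) (toℕ top) ≡ M (lookup m′) (toℕ top)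
  M-top-reach is-top ε = refl
  M-top-reach {top} is-top (_◅_ {m} {m′} step path) with step-shape {m} {m′} step
  ... | p , q , x , _ , same , before , after = trans (trans (M-cong before (toℕ top)) (trans
      (M-exchange (toℕ top) x same (λ eq → <-irrefl (trans (sym eq) is-top) (toℕ<n (lvP p))))
      (sym (M-cong after (toℕ top))))) (M-top-reach is-top path)

  live⇒NCondition : ∀ m → Live L m → NCondition L m
  live⇒NCondition m live = top-marked , φ≤
    where
    top-marked : ∀ top → suc (toℕ top) ≡ n → 0 < markOf L m top
    -- As there are at least two levels, `linked` yields a transition of the top level. Liveness
    -- enables it eventually, which requires a token there, and the top count never changes.
    top-marked top is-top with linked top (≤-pred (≤-trans two≤n (≤-reflexive (sym is-top))))
    ... | t , _ , t≡top , _ with live m ε t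
    ...   | m′ , path , enabled = begin
      1                             ≡⟨ pre-inP t ⟨
      pre t (inP t)                 ≤⟨ enabled (inP t) ⟩
      lookup m′ (inP t)             ≤⟨ term≤cnt (λ p → lv p ≟ toℕ top) (inP t) (cong toℕ (trans (inP-level t) t≡top)) ⟩
      M (lookup m′) (toℕ top)       ≡⟨ M-top-reach is-top path ⟨
      M (lookup m) (toℕ top)        ≡⟨ markOf≡M m top ⟨
      markOf L m top                ∎
      where open ≤-Reasoning
    φ≤ : ∀ j q → suc (toℕ q) ≡ toℕ j → φ L j m ≤ markOf L m q
    φ≤ j q below = ≮⇒≥ impossible
      where
      impossible : ¬ markOf L m q < φ L j m
      -- Liveness would eventually enable a transition of level `j`, although starvation persists
      -- until then.
      impossible <φ with linked j (≤-trans (s≤s z≤n) (≤-reflexive below))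
      ... | t , _ , t≡j , _ with live m ε t
      ...   | m′ , path , enabled with step-shape {m′} {fire L m′ t} (t , enabled , refl)
      ...     | p , _ , _ , p≡t , _ , before , _ =
        starved-excludes (starved-reach path (φ-starved m below <φ)) before (trans p≡t t≡j)

  -- Liveness passes to reachable markings, so the n-condition may be derived at `m` itself.
  reachable⇒InS : ∀ {m₀ m} → Live L m₀ → Reach L m₀ m → InS L m₀ m
  reachable⇒InS {m₀} {m} live path = live⇒NCondition m (λ m′ path′ → live m′ (path ◅◅ path′)) ,
    λ i → trans (witnessOf≡F m i) (trans (sym (F-reach (toℕ i) path)) (sym (witnessOf≡F m₀ i)))

  -- Both markings settle into flat ones with equal witness sums, hence equal level sums;
  -- `rearrangeable` joins these, and the settling of `m` is reversed.
  InS⇒reachable : ∀ {m₀ m} → Live L m₀ → InS L m₀ m → Reach L m₀ m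
  InS⇒reachable {m₀} {m} live (ncond , same-witness) =
    subst (λ v → Reach L v m) (tabulate∘lookup m₀) (subst (Reach L (tabulate (lookup m₀))) (tabulate∘lookup m)
      (reach S₀ ◅◅ rearrangeable n ≤-refl (flat S₀) (flat S) (rich S₀)
        -- With `k` = `n` no place is left on which the two markings must agree exactly.
        (λ r n≤r → contradiction (toℕ<n (lvP r)) (≤⇒≯ n≤r)) (λ l _ → flat-counts (flat S₀) (flat S) F-settled l)
      ◅◅ Reach-sym (reach S)))
    where
    open Settled
    S₀-all = settle n ≤-refl (lookup m₀) (supplied m₀ (live⇒NCondition m₀ live))
    S-all = settle n ≤-refl (lookup m) (supplied m ncond)
    S₀ = proj₂ S₀-all
    S = proj₂ S-all
    F-initial : ∀ l → F l (lookup m₀) ≡ F l (lookup m)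
    F-initial l with l <? n
    ... | no l≮n  = trans (F-out (≮⇒≥ l≮n) (lookup m₀)) (sym (F-out (≮⇒≥ l≮n) (lookup m)))
    ... | yes l<n = subst (λ k → F k (lookup m₀) ≡ F k (lookup m)) (toℕ-fromℕ< l<n)
      (trans (sym (witnessOf≡F m₀ i)) (trans (sym (same-witness i)) (witnessOf≡F m i)))
      where i = fromℕ< l<n
    F-settled : ∀ l → F l (proj₁ S₀-all) ≡ F l (proj₁ S-all)
    F-settled l = trans (sym (F-⇝ l (reach S₀))) (trans (F-initial l) (F-⇝ l (reach S)))

theorem3 : (L : LNet) → IsΠ3Net L → (m0 : Marking L) → Live L m0 →
    ∀ (m : Marking L) → (Reach L m0 m → InS L m0 m) × (InS L m0 m → Reach L m0 m)
theorem3 L Π³ m0 live m = reachable⇒InS live , InS⇒reachable live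
  where open Reachability L Π³
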